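{- Let $G$ be a $2r$-regular graph of order $m\ge 3$ with $\chi(G)=\chi_{la}(G)$. If $r\ge 2$, $r\ge t\ge 1$ and $m-2t\ge 2$, then $\chi_{la}(G\vee O_{m-2t})=\chi_{la}(G)+1$. In particular, let $G_0=G$ and $G_{k+1}=G_k\vee O_{m-2r}$ for $k\ge 0$; if $m$ is even and $m-2r\ge 2$, then $G_{k+1}$ is a $(2r+(k+1)(m-2r))$-regular graph of order $m+(k+1)(m-2r)$, and $\chi_{la}(G_k)=\chi_{la}(G)+k$ for all $k\ge 0$.
   Context: $O_n$ denotes the graph on $n$ vertices with no edges. For vertex-disjoint graphs $G,H$, the join $G\vee H$ has vertex set $V(G)\cup V(H)$ and edge set $E(G)\cup E(H)\cup\{uv: u\in V(G), v\in V(H)\}$; in the iteration each $O_{m-2r}$ is a fresh vertex-disjoint copy. $\chi$ is the chromatic number. For a simple graph with $q$ edges, a bijection $f:E\to\{1,\dots,q\}$ is a local antimagic labeling if $f^+(u)\neq f^+(v)$ for every edge $uv$, where $f^+(u)=\sum_{e\ni u} f(e)$; $\chi_{la}$ is the minimum number of distinct values of $f^+$ over all local antimagic labelings. -}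

module Defs where

open import Data.Bool using (Bool; true; false; if_then_else_)
open import Data.Nat using (ℕ; zero; suc; _+_; _*_; _≤_; _<ᵇ_)
import Data.Nat as ℕ
open import Data.Fin using (Fin; toℕ; splitAt)
open import Data.Sum using (inj₁; inj₂)
open import Data.Product using (Σ; _×_; _,_; ∃)
open import Data.Nat.ListAction using (sum)
open import Data.List using (List; []; _∷_; length; map; concatMap; filterᵇ; deduplicate; upTo)
open import Data.List.Relation.Binary.Permutation.Propositional using (_↭_)

open import Data.List using () renaming (allFin to allFinL)
open import Relation.Binary.PropositionalEquality using (_≡_; _≢_; refl)

record Graph : Set where
  field
    n     : ℕ
    adj   : Fin n → Fin n → Bool
    sym   : ∀ i j → adj i j ≡ adj j i
    irr   : ∀ i → adj i i ≡ false
open Graph public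

order : Graph → ℕ
order G = n G

verts : (G : Graph) → List (Fin (n G))
verts G = allFinL (n G)

deg : (G : Graph) → Fin (n G) → ℕ
deg G u = length (filterᵇ (adj G u) (verts G))

Regular : Graph → ℕ → Set
Regular G k = ∀ u → deg G u ≡ k

edges : (G : Graph) → List (Fin (n G) × Fin (n G))
edges G = concatMap (λ i → map (λ j → (i , j))
            (filterᵇ (λ j → if toℕ i <ᵇ toℕ j then adj G i j else false) (verts G)))
          (verts G)

size : Graph → ℕ
size G = length (edges G)

O : ℕ → Graph
O k = record { n = k ; adj = λ _ _ → false ; sym = λ _ _ → refl ; irr = λ _ → refl }

joinAdj : (G H : Graph) → Fin (n G + n H) → Fin (n G + n H) → Bool
joinAdj G H x y with splitAt (n G) x | splitAt (n G) y
... | inj₁ i | inj₁ j = adj G i j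
... | inj₂ i | inj₂ j = adj H i j
... | inj₁ _ | inj₂ _ = true
... | inj₂ _ | inj₁ _ = true

joinSym : (G H : Graph) → ∀ x y → joinAdj G H x y ≡ joinAdj G H y x
joinSym G H x y with splitAt (n G) x | splitAt (n G) y
... | inj₁ i | inj₁ j = sym G i j
... | inj₂ i | inj₂ j = sym H i j
... | inj₁ _ | inj₂ _ = refl
... | inj₂ _ | inj₁ _ = refl

joinIrr : (G H : Graph) → ∀ x → joinAdj G H x x ≡ false
joinIrr G H x with splitAt (n G) x
... | inj₁ i = irr G i
... | inj₂ i = irr H i

_∨G_ : Graph → Graph → Graph
G ∨G H = record { n = n G + n H ; adj = joinAdj G H ; sym = joinSym G H ; irr = joinIrr G H }

ProperColouring : (G : Graph) (k : ℕ) → (Fin (n G) → Fin k) → Set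
ProperColouring G k c = ∀ u v → adj G u v ≡ true → c u ≢ c v

Colourable : Graph → ℕ → Set
Colourable G k = Σ (Fin (n G) → Fin k) (ProperColouring G k)

IsChromaticNumber : Graph → ℕ → Set
IsChromaticNumber G k = Colourable G k × (∀ k' → Colourable G k' → k ≤ k')

-- Local antimagic labelings.
-- An edge labeling is given by a symmetric function ℓ on pairs of vertices;
-- only its values on edges matter.  f(uv) = ℓ u v.

edgeLabels : (G : Graph) → (Fin (n G) → Fin (n G) → ℕ) → List ℕ
edgeLabels G ℓ = map (λ { (i , j) → ℓ i j }) (edges G)

vsum : (G : Graph) → (Fin (n G) → Fin (n G) → ℕ) → Fin (n G) → ℕ
vsum G ℓ u = sum (map (ℓ u) (filterᵇ (adj G u) (verts G)))

oneTo : ℕ → List ℕ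
oneTo q = map suc (upTo q)

-- ℓ is a local antimagic labeling: the labels restricted to E are a
-- bijection E → {1,…,q}, and adjacent vertices get distinct sums
IsLocalAntimagic : (G : Graph) → (Fin (n G) → Fin (n G) → ℕ) → Set
IsLocalAntimagic G ℓ =
  (∀ u v → ℓ u v ≡ ℓ v u) ×
  (edgeLabels G ℓ ↭ oneTo (size G)) ×
  (∀ u v → adj G u v ≡ true → vsum G ℓ u ≢ vsum G ℓ v)

numColours : (G : Graph) → (Fin (n G) → Fin (n G) → ℕ) → ℕ
numColours G ℓ = length (deduplicate ℕ._≟_ (map (vsum G ℓ) (verts G)))

IsLocalAntimagicChromaticNumber : Graph → ℕ → Set
IsLocalAntimagicChromaticNumber G k =
  (Σ (Fin (n G) → Fin (n G) → ℕ) λ ℓ → IsLocalAntimagic G ℓ × numColours G ℓ ≡ k) ×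
  (∀ ℓ → IsLocalAntimagic G ℓ → k ≤ numColours G ℓ)

iterJoin : Graph → ℕ → ℕ → Graph
iterJoin G s zero    = G
iterJoin G s (suc k) = iterJoin G s k ∨G O s

{-# OPTIONS --safe #-}
module Submission where

-- Let m and s = m - 2t be the orders of G and of the added graph, and N = ms. The edges between G and O_s get the labels
-- 1, …, N, arranged as an m × s magic rectangle, and every label of an optimal labeling of G is raised by N. All vertices
-- of G then gain the same amount, all new vertices have the same sum m(N + 1)/2, and this sum is smaller than that of any
-- vertex of G, because 2t(N + 1) < 4rN. Hence one new colour suffices; it is necessary because χ(G ∨ O_s) = χ(G) + 1.
--
-- A magic rectangle amounts to an array of the numbers 2l - (N + 1), 1 ≤ l ≤ N, with zero row and column sums. Its columns
-- are mostly taken in pairs v, -v, so that rows are balanced automatically and one has to split a set of positive numbers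
-- into sets of m numbers with a vanishing signed sum. For odd m three more columns are needed; they come from a Kotzig
-- array.

-- The obstacle is parity. If half of a run of 2n numbers with spacing 2 is taken negatively, the
-- total runs through all 2n² - 4e with e ≤ n², and only these residues modulo 4 occur. A column of
-- consecutive numbers thus balances at once if 4 divides m; for m ≡ 2 modulo 4 it misses by 2, and
-- neighbouring blocks have to trade an element. For odd m a column consists of a block of m - 1
-- numbers and a single one. The singles are consecutive too, hence alternately right and wrong for
-- their blocks, and a trade repairs two wrong ones. If an odd number of them is wrong, the level of
-- m numbers reserved for the three special columns is moved below the top level: then a block can
-- jump across it, and a lone single changes its parity. So the number of singles modulo 4 decides
-- the case. In the iteration, order minus degree remains m - 2r, so every step adds the same number
-- of vertices, with t half of the current degree; m even keeps this degree even. The equality of χ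
-- and the local antimagic number is carried along, because the lower bound of each step rests on χ.

module MagicRectangles where

  open import Data.Nat as ℕ using (ℕ; zero; suc; z≤n; s≤s)
  import Data.Nat.Properties as ℕₚ
  import Data.Nat.Tactic.RingSolver as ℕSolver
  open import Data.Nat.ListAction using (sum)
  open import Data.Integer using (ℤ; +_; -_; _+_; _*_; _-_; ∣_∣)
  open import Data.Integer.Properties using (+-identityˡ; +-identityʳ; +-assoc; +-injective; neg-involutive; neg-distrib-+; pos-*; ≤-decTotalOrder) renaming (_≟_ to _≟ℤ_)
  open import Data.Integer.Tactic.RingSolver using (solve-∀)
  open import Data.Fin using (Fin; zero; suc)
  open import Data.Fin.Properties using (all?)
  open import Data.List using (List; []; _∷_; _++_; [_]; map; foldr; length; lookup; tabulate; concat; concatMap; applyUpTo)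
  open import Data.List.Properties using (map-++; ++-assoc; ++-identityʳ; length-++; length-map; map-∘; map-id; map-cong; tabulate-lookup; tabulate-cong; map-tabulate; map-applyUpTo; concat-map; concatMap-++)
  open import Data.List.Membership.Propositional.Properties using (∈-lookup)
  open import Data.List.Relation.Unary.All as All using (All; []; _∷_)
  open import Data.List.Relation.Unary.All.Properties using (concat⁻; tabulate⁻) renaming (++⁺ to All-++⁺)
  open import Data.List.Relation.Binary.Permutation.Propositional using (_↭_; ↭-refl; ↭-reflexive; ↭-sym; ↭-trans; ↭-prep; module PermutationReasoning)
  open import Data.List.Relation.Binary.Permutation.Propositional.Properties using (map⁺; ++⁺; ++⁺ˡ; ++⁺ʳ; shift; shifts; ++-comm; ↭-length; ++-commutativeMonoid; All-resp-↭)
  open import Data.List.Sort.InsertionSort.Base ≤-decTotalOrder using (sort)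
  open import Data.List.Sort.InsertionSort.Properties ≤-decTotalOrder using (sort-↭)
  open import Data.Product using (_×_; _,_; ∃; proj₁; proj₂)
  open import Data.Sum using (_⊎_; inj₁; inj₂; [_,_]′)
  open import Data.Vec as Vec using (Vec; []; _∷_)
  open import Relation.Binary.PropositionalEquality using (_≡_; refl; sym; trans; cong; cong₂; subst)
  open import Relation.Nullary using (yes; no)
  open import Relation.Nullary.Decidable using (True; toWitness)
  import Algebra.Solver.CommutativeMonoid as CommutativeMonoidSolver
  open import Defs using (oneTo)

  open CommutativeMonoidSolver (++-commutativeMonoid {A = ℤ}) using (_⊕_; _⊜_) renaming (solve to ++-solve; id to ∅)

  -- Signed sums

  Σℤ : List ℤ → ℤ
  Σℤ = foldr _+_ (+ 0)

  Σℤ-++ : ∀ xs ys → Σℤ (xs ++ ys) ≡ Σℤ xs + Σℤ ys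
  Σℤ-++ []       ys = sym (+-identityˡ _)
  Σℤ-++ (x ∷ xs) ys = trans (cong (λ z → x + z) (Σℤ-++ xs ys)) (sym (+-assoc x (Σℤ xs) (Σℤ ys)))

  Σℤ-neg : ∀ xs → Σℤ (map -_ xs) ≡ - Σℤ xs
  Σℤ-neg []       = refl
  Σℤ-neg (x ∷ xs) = trans (cong (λ z → - x + z) (Σℤ-neg xs)) (sym (neg-distrib-+ x (Σℤ xs)))

  -- Spacing 2 is that of the centred labels 2l - (N + 1), so consecutive labels form a run.
  run : ℤ → ℕ → List ℤ
  run a zero    = []
  run a (suc n) = a ∷ run (a + + 2) n

  run-length : ∀ a n → length (run a n) ≡ n
  run-length a zero    = refl
  run-length a (suc n) = cong suc (run-length (a + + 2) n)

  run-≡ : ∀ {a b m n} → a ≡ b → m ≡ n → run a m ≡ run b n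
  run-≡ = cong₂ run

  run-++ : ∀ a m n → run a (m ℕ.+ n) ≡ run a m ++ run (a + + 2 * + m) n
  run-++ a zero    n = run-≡ {n = n} (sym (+-identityʳ a)) refl
  run-++ a (suc m) n = cong (a ∷_) (trans (run-++ (a + + 2) m n)
    (cong (λ z → run (a + + 2) m ++ run z n) (eq a (+ m))))
    where
    eq : ∀ a m → a + + 2 + + 2 * m ≡ a + + 2 * (+ 1 + m)
    eq = solve-∀

  run-∷ʳ : ∀ a n → run a (suc n) ≡ run a n ++ [ a + + 2 * + n ]
  run-∷ʳ a n = trans (run-≡ {a} refl (ℕₚ.+-comm 1 n)) (run-++ a n 1)

  neg-run : ∀ a n → map -_ (run a n) ↭ run (+ 2 - a - + 2 * + n) n
  neg-run a zero    = ↭-refl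
  neg-run a (suc n) = begin
    - a ∷ map -_ (run (a + + 2) n)                       ↭⟨ ↭-prep _ (neg-run (a + + 2) n) ⟩
    - a ∷ run (+ 2 - (a + + 2) - + 2 * + n) n            ≡⟨ cong (- a ∷_) (run-≡ {n = n} (eq₁ a (+ n)) refl) ⟩
    [ - a ] ++ run (+ 2 - a - + 2 * + suc n) n           ↭⟨ ++-comm [ - a ] _ ⟩
    run (+ 2 - a - + 2 * + suc n) n ++ [ - a ]           ≡⟨ cong (λ z → run (+ 2 - a - + 2 * + suc n) n ++ [ z ]) (eq₂ a (+ n)) ⟩
    run (+ 2 - a - + 2 * + suc n) n ++ [ + 2 - a - + 2 * + suc n + + 2 * + n ] ≡⟨ run-∷ʳ (+ 2 - a - + 2 * + suc n) n ⟨
    run (+ 2 - a - + 2 * + suc n) (suc n)                ∎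
    where
    open PermutationReasoning
    eq₁ : ∀ a n → + 2 - (a + + 2) - + 2 * n ≡ + 2 - a - + 2 * (+ 1 + n)
    eq₁ = solve-∀
    eq₂ : ∀ a n → - a ≡ + 2 - a - + 2 * (+ 1 + n) + + 2 * n
    eq₂ = solve-∀

  ± : List ℤ → List ℤ
  ± xs = xs ++ map -_ xs

  ±-++ : ∀ xs ys → ± (xs ++ ys) ↭ ± xs ++ ± ys
  ±-++ xs ys rewrite map-++ -_ xs ys =
    ++-solve 4 (λ a b c d → (a ⊕ b) ⊕ (c ⊕ d) ⊜ (a ⊕ c) ⊕ (b ⊕ d)) ↭-refl xs ys (map -_ xs) (map -_ ys)

  ±-↭ : ∀ {xs ys} → xs ↭ ys → ± xs ↭ ± ys
  ±-↭ p = ++⁺ p (map⁺ -_ p)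

  ±-neg : ∀ xs → ± (map -_ xs) ↭ ± xs
  ±-neg xs = begin
    map -_ xs ++ map -_ (map -_ xs)  ≡⟨ cong (map -_ xs ++_) (trans (sym (map-∘ xs)) (trans (map-cong neg-involutive xs) (map-id xs))) ⟩
    map -_ xs ++ xs                  ↭⟨ ++-comm (map -_ xs) xs ⟩
    xs ++ map -_ xs                  ∎
    where open PermutationReasoning

  ±-length : ∀ xs → length (± xs) ≡ length xs ℕ.+ length xs
  ±-length xs = trans (length-++ xs) (cong (length xs ℕ.+_) (length-map -_ xs))

  -- The sign given to each element is not recorded: a column is always entered together with its
  -- negative, so only `± values` matters.
  record Signed (xs : List ℤ) (d : ℤ) : Set where
    constructor signed
    field
      values : List ℤ
      total  : Σℤ values ≡ d
      perm   : ± values ↭ ± xs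

  module _ {xs : List ℤ} {d : ℤ} where

    signed-≡ : ∀ {e} → d ≡ e → Signed xs d → Signed xs e
    signed-≡ refl v = v

    signed-↭ : ∀ {ys} → xs ↭ ys → Signed xs d → Signed ys d
    signed-↭ p (signed v t q) = signed v t (↭-trans q (±-↭ p))

    signed-neg : Signed xs d → Signed xs (- d)
    signed-neg (signed v t q) = signed (map -_ v) (trans (Σℤ-neg v) (cong -_ t)) (↭-trans (±-neg v) q)

    signed-++ : ∀ {ys e} → Signed xs d → Signed ys e → Signed (xs ++ ys) (d + e)
    signed-++ {ys} (signed v t q) (signed v′ t′ q′) =
      signed (v ++ v′) (trans (Σℤ-++ v v′) (cong₂ _+_ t t′))
        (↭-trans (±-++ v v′) (↭-trans (++⁺ q q′) (↭-sym (±-++ xs ys))))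

  signed-list : ∀ xs → Signed xs (Σℤ xs)
  signed-list xs = signed xs refl ↭-refl

  signed-single : ∀ x → Signed [ x ] x
  signed-single x = signed-≡ (+-identityʳ x) (signed-list [ x ])

  signed-pair : ∀ x y → Signed (x ∷ y ∷ []) (y - x)
  signed-pair x y = signed-≡ (eq x y) (signed-++ (signed-neg (signed-single x)) (signed-single y))
    where
    eq : ∀ x y → - x + y ≡ y - x
    eq = solve-∀

  signed-length : ∀ {xs d} (v : Signed xs d) → length (Signed.values v) ≡ length xs
  signed-length {xs} (signed v _ q) = half (trans (sym (±-length v)) (trans (↭-length q) (±-length xs)))
    where
    half : ∀ {m n} → m ℕ.+ m ≡ n ℕ.+ n → m ≡ n
    half {m} {n} e = ℕₚ.*-cancelˡ-≡ m n 2
      (trans (cong (m ℕ.+_) (ℕₚ.+-identityʳ m)) (trans e (cong (n ℕ.+_) (sym (ℕₚ.+-identityʳ n)))))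

  run-ends : ∀ a n → run a (suc n ℕ.+ suc n) ↭ (a ∷ a + + 2 * + (suc n ℕ.+ n) ∷ []) ++ run (a + + 2) (n ℕ.+ n)
  run-ends a n = begin
    a ∷ run (a + + 2) (n ℕ.+ suc n)
      ≡⟨ cong (a ∷_) (trans (run-≡ {a + + 2} refl (ℕₚ.+-suc n n)) (run-∷ʳ (a + + 2) (n ℕ.+ n))) ⟩
    a ∷ (run (a + + 2) (n ℕ.+ n) ++ [ a + + 2 + + 2 * + (n ℕ.+ n) ])
      ↭⟨ ↭-prep a (++-comm (run (a + + 2) (n ℕ.+ n)) _) ⟩
    a ∷ a + + 2 + + 2 * + (n ℕ.+ n) ∷ run (a + + 2) (n ℕ.+ n)
      ≡⟨ cong (λ z → a ∷ z ∷ run (a + + 2) (n ℕ.+ n)) (eq a (+ (n ℕ.+ n))) ⟩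
    a ∷ a + + 2 * + (suc n ℕ.+ n) ∷ run (a + + 2) (n ℕ.+ n) ∎
    where
    open PermutationReasoning
    eq : ∀ a n → a + + 2 + + 2 * n ≡ a + + 2 * (+ 1 + n)
    eq = solve-∀

  sq : ℕ → ℕ
  sq n = n ℕ.* n

  sq-suc : ∀ n → sq (suc n) ≡ sq n ℕ.+ suc (n ℕ.+ n)
  sq-suc n = trans (cong suc (trans (cong (n ℕ.+_) (ℕₚ.*-suc n n)) (trans (sym (ℕₚ.+-assoc n n (sq n))) (ℕₚ.+-comm (n ℕ.+ n) (sq n)))))
                   (sym (ℕₚ.+-suc (sq n) (n ℕ.+ n)))

  -- In the induction step of `balanced` the outermost pair counts positively (`small`) or
  -- negatively (`large`). The ranges e ≤ n² and e ≥ 2n + 1 leave a gap only where n² < 2n, that is,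
  -- at n = 1 and e = 2.
  data Split (n e : ℕ) : Set where
    small  : e ℕ.≤ sq n → Split n e
    large  : ∀ e′ → e′ ℕ.≤ sq n → e ≡ e′ ℕ.+ suc (n ℕ.+ n) → Split n e
    middle : n ≡ 1 → e ≡ 2 → Split n e

  split : ∀ n e → e ℕ.≤ sq (suc n) → Split n e
  split n e e≤ with e ℕ.≤? sq n
  ... | yes p = small p
  ... | no ¬p with suc (n ℕ.+ n) ℕ.≤? e
  ...   | yes q = large (e ℕ.∸ suc (n ℕ.+ n))
            (ℕₚ.≤-trans (ℕₚ.∸-monoˡ-≤ (suc (n ℕ.+ n)) (subst (e ℕ.≤_) (sq-suc n) e≤))
                        (ℕₚ.≤-reflexive (ℕₚ.m+n∸n≡m (sq n) (suc (n ℕ.+ n)))))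
            (sym (ℕₚ.m∸n+n≡m q))
  ...   | no ¬q = exceptional n (ℕₚ.≰⇒> ¬p) (ℕₚ.≤-pred (ℕₚ.≰⇒> ¬q))
    where
    exceptional : ∀ n → sq n ℕ.< e → e ℕ.≤ n ℕ.+ n → Split n e
    exceptional zero p q with () ← ℕₚ.<-≤-trans p q
    exceptional (suc zero) p q = middle refl (ℕₚ.≤-antisym q p)
    exceptional (suc (suc n)) p q with () ← ℕₚ.<⇒≱ (ℕₚ.<-≤-trans p q)
      (ℕₚ.+-monoʳ-≤ (suc (suc n)) (ℕₚ.m≤m+n (suc (suc n)) _))

  -- The outermost pair of the run contributes ±(4n + 2), the inner run the rest.
  balanced : ∀ n a e → e ℕ.≤ sq n → Signed (run a (n ℕ.+ n)) (+ 2 * + sq n - + 4 * + e)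
  balanced zero    a zero e≤ = signed-list []
  balanced (suc n) a e e≤ with split n e e≤
  ... | small e≤n² = signed-≡ (ring a (+ n) (+ sq n) (+ e) (cong +_ (sq-suc n)))
        (signed-↭ (↭-sym (run-ends a n))
          (signed-++ (signed-pair a _) (balanced n (a + + 2) e e≤n²)))
    where
    ring′ : ∀ a n q e → (a + + 2 * (+ 1 + (n + n)) - a) + (+ 2 * q - + 4 * e) ≡ + 2 * (q + (+ 1 + (n + n))) - + 4 * e
    ring′ = solve-∀
    ring : ∀ a n q e {Q} → Q ≡ q + (+ 1 + (n + n)) →
           (a + + 2 * (+ 1 + (n + n)) - a) + (+ 2 * q - + 4 * e) ≡ + 2 * Q - + 4 * e
    ring a n q e refl = ring′ a n q e
  ... | large e′ e′≤n² e≡ = signed-≡ (ring a (+ n) (+ sq n) (+ e′) (cong +_ (sq-suc n)) (cong +_ e≡))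
        (signed-↭ (↭-sym (run-ends a n))
          (signed-++ (signed-neg (signed-pair a _)) (balanced n (a + + 2) e′ e′≤n²)))
    where
    ring′ : ∀ a n q e → - (a + + 2 * (+ 1 + (n + n)) - a) + (+ 2 * q - + 4 * e)
                       ≡ + 2 * (q + (+ 1 + (n + n))) - + 4 * (e + (+ 1 + (n + n)))
    ring′ = solve-∀
    ring : ∀ a n q e {Q E} → Q ≡ q + (+ 1 + (n + n)) → E ≡ e + (+ 1 + (n + n)) →
           - (a + + 2 * (+ 1 + (n + n)) - a) + (+ 2 * q - + 4 * e) ≡ + 2 * Q - + 4 * E
    ring a n q e refl refl = ring′ a n q e
  -- Neighbours are paired here, with differences 2 and -2; nested pairs of four values would give
  -- only ±6 ± 2, never 0.
  ... | middle refl refl = signed-≡ (ring a)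
    (signed-++ (signed-pair a (a + + 2)) (signed-neg (signed-pair (a + + 2 + + 2) (a + + 2 + + 2 + + 2))))
    where
    ring : ∀ a → (a + + 2 - a) + - (a + + 2 + + 2 + + 2 - (a + + 2 + + 2)) ≡ + 0
    ring = solve-∀

  -- Zero-sum arrays

  -- The entries are listed column by column, since arrays are built by adding columns.
  record ZeroSum (m s : ℕ) (xs : List ℤ) : Set where
    field
      entry   : Fin m → Fin s → ℤ
      row-sum : ∀ i → Σℤ (tabulate (entry i)) ≡ + 0
      col-sum : ∀ j → Σℤ (tabulate λ i → entry i j) ≡ + 0
      perm    : concat (tabulate λ j → tabulate λ i → entry i j) ↭ xs
  open ZeroSum public

  zeroSum-↭ : ∀ {m s xs ys} → xs ↭ ys → ZeroSum m s xs → ZeroSum m s ys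
  zeroSum-↭ p A = record { entry = entry A ; row-sum = row-sum A ; col-sum = col-sum A ; perm = ↭-trans (perm A) p }

  zeroSum-[] : ∀ {m} → ZeroSum m 0 []
  zeroSum-[] = record { entry = λ _ () ; row-sum = λ _ → refl ; col-sum = λ () ; perm = ↭-refl }

  addPair : ∀ {m s xs} (v : List ℤ) → length v ≡ m → Σℤ v ≡ + 0 →
            ZeroSum m s xs → ZeroSum m (2 ℕ.+ s) (± v ++ xs)
  addPair {s = s} {xs} v refl v≡0 A = record
    { entry = e ; row-sum = row ; col-sum = col ; perm = p }
    where
    e : Fin (length v) → Fin (2 ℕ.+ s) → ℤ
    e i zero          = lookup v i
    e i (suc zero)    = - lookup v i
    e i (suc (suc j)) = entry A i j
    ring : ∀ x → x + (- x + + 0) ≡ + 0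
    ring = solve-∀
    row : ∀ i → Σℤ (tabulate (e i)) ≡ + 0
    row i = trans (cong (λ z → lookup v i + (- lookup v i + z)) (row-sum A i)) (ring (lookup v i))
    neg-v : tabulate (λ i → - lookup v i) ≡ map -_ v
    neg-v = trans (sym (map-tabulate (lookup v) (-_))) (cong (map (-_)) (tabulate-lookup v))
    col : ∀ j → Σℤ (tabulate λ i → e i j) ≡ + 0
    col zero          = trans (cong Σℤ (tabulate-lookup v)) v≡0
    col (suc zero)    = trans (cong Σℤ neg-v) (trans (Σℤ-neg v) (cong -_ v≡0))
    col (suc (suc j)) = col-sum A j
    p : concat (tabulate λ j → tabulate λ i → e i j) ↭ ± v ++ xs
    p rewrite tabulate-lookup v | neg-v =
      ↭-trans (++⁺ˡ v (++⁺ˡ (map -_ v) (perm A))) (↭-reflexive (sym (++-assoc v (map -_ v) xs)))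

  -- Pairs m k xs: the values ±x, x ∈ xs, fill k pairs of opposite zero-sum columns of height m.
  data Pairs (m : ℕ) : ℕ → List ℤ → Set where
    none  : Pairs m 0 []
    one   : ∀ {xs} → length xs ≡ m → Signed xs (+ 0) → Pairs m 1 xs
    _⊎ₚ_  : ∀ {k l xs ys} → Pairs m k xs → Pairs m l ys → Pairs m (k ℕ.+ l) (xs ++ ys)
    permₚ : ∀ {k xs ys} → xs ↭ ys → Pairs m k xs → Pairs m k ys

  pairs-≡ : ∀ {m k l xs} → k ≡ l → Pairs m k xs → Pairs m l xs
  pairs-≡ refl P = P

  fill : ∀ {m s k xs ys} → Pairs m k xs → ZeroSum m s ys → ZeroSum m (k ℕ.* 2 ℕ.+ s) (± xs ++ ys)
  fill none A = A
  fill {ys = ys} (one len S) A = zeroSum-↭ (++⁺ʳ ys (Signed.perm S))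
    (addPair (Signed.values S) (trans (signed-length S) len) (Signed.total S) A)
  fill {m} {s} {ys = ys} (_⊎ₚ_ {k} {l} {xs} {xs′} P Q) A =
    subst (λ n → ZeroSum m n (± (xs ++ xs′) ++ ys))
      (trans (sym (ℕₚ.+-assoc (k ℕ.* 2) (l ℕ.* 2) s)) (cong (ℕ._+ s) (sym (ℕₚ.*-distribʳ-+ 2 k l))))
      (zeroSum-↭ p (fill P (fill Q A)))
    where
    p : ± xs ++ (± xs′ ++ ys) ↭ ± (xs ++ xs′) ++ ys
    p = ↭-trans (↭-reflexive (sym (++-assoc (± xs) (± xs′) ys))) (++⁺ʳ ys (↭-sym (±-++ xs xs′)))
  fill {ys = ys} (permₚ p P) A = zeroSum-↭ (++⁺ʳ ys (±-↭ p)) (fill P A)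

  Triple : Set
  Triple = ℤ × ℤ × ℤ

  ⟦_⟧ : Triple → List ℤ
  ⟦ x , y , z ⟧ = x ∷ y ∷ z ∷ []

  negT : Triple → Triple
  negT (x , y , z) = - x , - y , - z

  entries : List Triple → List ℤ
  entries = concatMap ⟦_⟧

  c₁ c₂ c₃ : Triple → ℤ
  c₁ (x , _ , _) = x
  c₂ (_ , y , _) = y
  c₃ (_ , _ , z) = z

  columns-↭ : ∀ rows → map c₁ rows ++ map c₂ rows ++ map c₃ rows ++ [] ↭ entries rows
  columns-↭ []                   = ↭-refl
  columns-↭ ((x , y , z) ∷ rows) = ↭-trans
    (++-solve 6 (λ x y z a b c → (x ⊕ a) ⊕ ((y ⊕ b) ⊕ ((z ⊕ c) ⊕ ∅)) ⊜ (x ⊕ (y ⊕ z)) ⊕ (a ⊕ (b ⊕ (c ⊕ ∅)))) ↭-refl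
       [ x ] [ y ] [ z ] (map c₁ rows) (map c₂ rows) (map c₃ rows))
    (++⁺ˡ (x ∷ y ∷ z ∷ []) (columns-↭ rows))

  fromRows : ∀ {m} rows → length rows ≡ m → All (λ t → Σℤ ⟦ t ⟧ ≡ + 0) rows →
             Σℤ (map c₁ rows) ≡ + 0 → Σℤ (map c₂ rows) ≡ + 0 → Σℤ (map c₃ rows) ≡ + 0 →
             ZeroSum m 3 (entries rows)
  fromRows rows refl rows≡0 c₁≡0 c₂≡0 c₃≡0 = record
    { entry = e ; row-sum = λ i → All.lookup rows≡0 (∈-lookup i) ; col-sum = col ; perm = p }
    where
    e : Fin (length rows) → Fin 3 → ℤ
    e i zero             = c₁ (lookup rows i)
    e i (suc zero)       = c₂ (lookup rows i)
    e i (suc (suc zero)) = c₃ (lookup rows i)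
    column : (c : Triple → ℤ) → tabulate (λ i → c (lookup rows i)) ≡ map c rows
    column c = trans (sym (map-tabulate (lookup rows) c)) (cong (map c) (tabulate-lookup rows))
    col : ∀ j → Σℤ (tabulate λ i → e i j) ≡ + 0
    col zero             = trans (cong Σℤ (column c₁)) c₁≡0
    col (suc zero)       = trans (cong Σℤ (column c₂)) c₂≡0
    col (suc (suc zero)) = trans (cong Σℤ (column c₃)) c₃≡0
    p : concat (tabulate λ j → tabulate λ i → e i j) ↭ entries rows
    p rewrite column c₁ | column c₂ | column c₃ = columns-↭ rows

  opposite : List Triple → List Triple
  opposite = concatMap (λ t → t ∷ negT t ∷ [])

  length-opposite : ∀ ts → length (opposite ts) ≡ length ts ℕ.* 2
  length-opposite []       = refl
  length-opposite (t ∷ ts) = cong (2 ℕ.+_) (length-opposite ts)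

  entries-opposite : ∀ ts → entries (opposite ts) ↭ ± (entries ts)
  entries-opposite []       = ↭-refl
  entries-opposite (t ∷ ts) = begin
    ⟦ t ⟧ ++ ⟦ negT t ⟧ ++ entries (opposite ts)  ↭⟨ ++⁺ˡ ⟦ t ⟧ (++⁺ˡ ⟦ negT t ⟧ (entries-opposite ts)) ⟩
    ± ⟦ t ⟧ ++ ± (entries ts)                     ↭⟨ ±-++ ⟦ t ⟧ (entries ts) ⟨
    ± (entries (t ∷ ts))                          ∎
    where open PermutationReasoning

  Σ-opposite : ∀ (c : Triple → ℤ) → (∀ t → c (negT t) ≡ - c t) → ∀ ts → Σℤ (map c (opposite ts)) ≡ + 0
  Σ-opposite c odd []       = refl
  Σ-opposite c odd (t ∷ ts) = trans (cong₂ (λ y z → c t + (y + z)) (odd t) (Σ-opposite c odd ts)) (ring (c t))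
    where
    ring : ∀ x → x + (- x + + 0) ≡ + 0
    ring = solve-∀

  opposite-rows : ∀ {ts} → All (λ t → Σℤ ⟦ t ⟧ ≡ + 0) ts → All (λ t → Σℤ ⟦ t ⟧ ≡ + 0) (opposite ts)
  opposite-rows []                    = []
  opposite-rows (_∷_ {t} t≡0 ts≡0) = t≡0 ∷ trans (Σℤ-neg ⟦ t ⟧) (cong -_ t≡0) ∷ opposite-rows ts≡0

  -- Opposite rows cancel in every column, so only the central row (u , - u , 0) has to be compensated: exchanging the
  -- first two entries in one of two opposite rows changes the column sums by their difference.
  threeColumns : ∀ u x₁ y₁ z₁ x₂ y₂ z₂ x₃ y₃ z₃ ts → let all = (x₁ , y₁ , z₁) ∷ (x₂ , y₂ , z₂) ∷ (x₃ , y₃ , z₃) ∷ ts in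
    All (λ t → Σℤ ⟦ t ⟧ ≡ + 0) all → (y₁ - x₁) + (y₂ - x₂) ≡ u + (y₃ - x₃) →
    ZeroSum (suc (length all ℕ.* 2)) 3 ([ + 0 ] ++ ± (u ∷ entries all))
  threeColumns u x₁ y₁ z₁ x₂ y₂ z₂ x₃ y₃ z₃ ts (t₁ ∷ t₂ ∷ t₃ ∷ ts≡0) D = zeroSum-↭ p
    (fromRows (special ++ opposite ts) (cong (7 ℕ.+_) (length-opposite ts))
      (centre u ∷ t₁ ∷ swap x₁ y₁ z₁ t₁ ∷ t₂ ∷ swap x₂ y₂ z₂ t₂ ∷ flip x₃ y₃ z₃ t₃ ∷ neg x₃ y₃ z₃ t₃ ∷ opposite-rows ts≡0)
      (col₁ (Σ-opposite c₁ (λ _ → refl) ts)) (col₂ (Σ-opposite c₂ (λ _ → refl) ts)) (col₃ (Σ-opposite c₃ (λ _ → refl) ts)))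
    where
    special : List Triple
    special = (u , - u , + 0) ∷ (x₁ , y₁ , z₁) ∷ (- y₁ , - x₁ , - z₁) ∷ (x₂ , y₂ , z₂) ∷ (- y₂ , - x₂ , - z₂) ∷
              (y₃ , x₃ , z₃) ∷ (- x₃ , - y₃ , - z₃) ∷ []
    centre : ∀ u → u + (- u + (+ 0 + + 0)) ≡ + 0
    centre = solve-∀
    swap : ∀ x y z → x + (y + (z + + 0)) ≡ + 0 → - y + (- x + (- z + + 0)) ≡ + 0
    swap x y z e = trans (ring x y z) (cong -_ e)
      where
      ring : ∀ x y z → - y + (- x + (- z + + 0)) ≡ - (x + (y + (z + + 0)))
      ring = solve-∀
    flip : ∀ x y z → x + (y + (z + + 0)) ≡ + 0 → y + (x + (z + + 0)) ≡ + 0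
    flip x y z e = trans (ring x y z) e
      where
      ring : ∀ x y z → y + (x + (z + + 0)) ≡ x + (y + (z + + 0))
      ring = solve-∀
    neg : ∀ x y z → x + (y + (z + + 0)) ≡ + 0 → - x + (- y + (- z + + 0)) ≡ + 0
    neg x y z e = trans (ring x y z) (cong -_ e)
      where
      ring : ∀ x y z → - x + (- y + (- z + + 0)) ≡ - (x + (y + (z + + 0)))
      ring = solve-∀
    ring : ∀ u x₁ y₁ x₂ y₂ x₃ y₃ → u + (x₁ + (- y₁ + (x₂ + (- y₂ + (y₃ + (- x₃ + + 0)))))) ≡ (u + (y₃ - x₃)) - ((y₁ - x₁) + (y₂ - x₂))
    ring = solve-∀
    cancel : ∀ d → d - d ≡ + 0
    cancel = solve-∀
    ring₂ : ∀ u x₁ y₁ x₂ y₂ x₃ y₃ → - u + (y₁ + (- x₁ + (y₂ + (- x₂ + (x₃ + (- y₃ + + 0)))))) ≡ ((y₁ - x₁) + (y₂ - x₂)) - (u + (y₃ - x₃))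
    ring₂ = solve-∀
    ring₃ : ∀ x y z → + 0 + (x + (- x + (y + (- y + (z + (- z + + 0)))))) ≡ + 0
    ring₃ = solve-∀
    col₁ : ∀ {r} → r ≡ + 0 → u + (x₁ + (- y₁ + (x₂ + (- y₂ + (y₃ + (- x₃ + r)))))) ≡ + 0
    col₁ refl = trans (ring u x₁ y₁ x₂ y₂ x₃ y₃) (trans (cong (λ d → (u + (y₃ - x₃)) - d) D) (cancel (u + (y₃ - x₃))))
    col₂ : ∀ {r} → r ≡ + 0 → - u + (y₁ + (- x₁ + (y₂ + (- x₂ + (x₃ + (- y₃ + r)))))) ≡ + 0
    col₂ refl = trans (ring₂ u x₁ y₁ x₂ y₂ x₃ y₃) (trans (cong (λ d → d - (u + (y₃ - x₃))) D) (cancel (u + (y₃ - x₃))))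
    col₃ : ∀ {r} → r ≡ + 0 → + 0 + (z₁ + (- z₁ + (z₂ + (- z₂ + (z₃ + (- z₃ + r)))))) ≡ + 0
    col₃ refl = ring₃ z₁ z₂ z₃
    p : entries (special ++ opposite ts) ↭ [ + 0 ] ++ ± (u ∷ entries ((x₁ , y₁ , z₁) ∷ (x₂ , y₂ , z₂) ∷ (x₃ , y₃ , z₃) ∷ ts))
    p = begin
      entries (special ++ opposite ts)
        ↭⟨ ++⁺ˡ (entries special) (entries-opposite ts) ⟩
      entries special ++ ± (entries ts)
        ↭⟨ ++⁺ʳ (± (entries ts)) q ⟩
      ([ + 0 ] ++ ± (u ∷ entries (T₁ ∷ T₂ ∷ T₃ ∷ []))) ++ ± (entries ts)
        ↭⟨ ↭-prep (+ 0) (↭-sym (±-++ (u ∷ entries (T₁ ∷ T₂ ∷ T₃ ∷ [])) (entries ts))) ⟩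
      [ + 0 ] ++ ± (u ∷ entries (T₁ ∷ T₂ ∷ T₃ ∷ ts)) ∎
      where
      open PermutationReasoning
      T₁ T₂ T₃ : Triple
      T₁ = x₁ , y₁ , z₁
      T₂ = x₂ , y₂ , z₂
      T₃ = x₃ , y₃ , z₃
      q : entries special ↭ [ + 0 ] ++ ± (u ∷ entries (T₁ ∷ T₂ ∷ T₃ ∷ []))
      q = ↭-trans (shift (+ 0) (u ∷ - u ∷ []) _) (↭-prep (+ 0) r)
        where
        sw : ∀ x y z → x ∷ y ∷ z ∷ - y ∷ - x ∷ - z ∷ [] ↭ ± (x ∷ y ∷ z ∷ [])
        sw x y z = ++⁺ˡ (x ∷ y ∷ z ∷ []) (_↭_.swap _ _ ↭-refl)
        fl : ∀ x y z → y ∷ x ∷ z ∷ - x ∷ - y ∷ - z ∷ [] ↭ ± (x ∷ y ∷ z ∷ [])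
        fl x y z = _↭_.swap y x ↭-refl
        r : ± [ u ] ++ (x₁ ∷ y₁ ∷ z₁ ∷ - y₁ ∷ - x₁ ∷ - z₁ ∷ []) ++ (x₂ ∷ y₂ ∷ z₂ ∷ - y₂ ∷ - x₂ ∷ - z₂ ∷ []) ++
            (y₃ ∷ x₃ ∷ z₃ ∷ - x₃ ∷ - y₃ ∷ - z₃ ∷ []) ↭ ± (u ∷ entries (T₁ ∷ T₂ ∷ T₃ ∷ []))
        r = ↭-trans (++⁺ˡ (± [ u ]) (++⁺ (sw x₁ y₁ z₁) (++⁺ (sw x₂ y₂ z₂) (fl x₃ y₃ z₃))))
              (↭-sym (↭-trans (±-++ [ u ] (⟦ T₁ ⟧ ++ ⟦ T₂ ⟧ ++ ⟦ T₃ ⟧)) (++⁺ˡ (± [ u ]) (↭-trans (±-++ ⟦ T₁ ⟧ (⟦ T₂ ⟧ ++ ⟦ T₃ ⟧)) (++⁺ˡ (± ⟦ T₁ ⟧) (±-++ ⟦ T₂ ⟧ ⟦ T₃ ⟧))))))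

  -- Three columns from a Kotzig array

  down : ℤ → ℕ → List ℤ
  down y zero    = []
  down y (suc n) = y ∷ down (y - + 2) n

  down-≡ : ∀ y n → down y n ≡ map -_ (run (- y) n)
  down-≡ y zero    = refl
  down-≡ y (suc n) = cong₂ _∷_ (sym (neg-involutive y))
    (trans (down-≡ (y - + 2) n) (cong (λ z → map -_ (run z n)) (ring y)))
    where
    ring : ∀ y → - (y - + 2) ≡ - y + + 2
    ring = solve-∀

  by-fours : ℤ → ℕ → List ℤ
  by-fours x zero    = []
  by-fours x (suc n) = x ∷ by-fours (x + + 4) n

  interleave : ∀ x n → by-fours x n ++ by-fours (x + + 2) n ↭ run x (n ℕ.+ n)
  interleave x zero    = ↭-refl
  interleave x (suc n) = begin
    (x ∷ by-fours (x + + 4) n) ++ (x + + 2) ∷ by-fours (x + + 2 + + 4) n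
      ↭⟨ ↭-prep x (shift (x + + 2) (by-fours (x + + 4) n) _) ⟩
    x ∷ x + + 2 ∷ by-fours (x + + 4) n ++ by-fours (x + + 2 + + 4) n
      ≡⟨ cong₂ (λ a b → x ∷ x + + 2 ∷ by-fours a n ++ by-fours b n) (ring₁ x) (ring₂ x) ⟩
    x ∷ x + + 2 ∷ by-fours (x + + 2 + + 2) n ++ by-fours (x + + 2 + + 2 + + 2) n
      ↭⟨ ↭-prep x (↭-prep (x + + 2) (interleave (x + + 2 + + 2) n)) ⟩
    x ∷ x + + 2 ∷ run (x + + 2 + + 2) (n ℕ.+ n)
      ≡⟨ cong (x ∷_) (run-≡ {x + + 2} refl (sym (ℕₚ.+-suc n n))) ⟩
    run x (suc n ℕ.+ suc n) ∎
    where
    open PermutationReasoning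
    ring₁ : ∀ x → x + + 4 ≡ x + + 2 + + 2
    ring₁ = solve-∀
    ring₂ : ∀ x → x + + 2 + + 4 ≡ x + + 2 + + 2 + + 2
    ring₂ = solve-∀

  interleave-suc : ∀ x n → by-fours x (suc n) ++ by-fours (x + + 2) n ↭ run x (suc n ℕ.+ n)
  interleave-suc x n = ↭-prep x (begin
    by-fours (x + + 4) n ++ by-fours (x + + 2) n        ↭⟨ ++-comm (by-fours (x + + 4) n) _ ⟩
    by-fours (x + + 2) n ++ by-fours (x + + 4) n        ≡⟨ cong (λ z → by-fours (x + + 2) n ++ by-fours z n) (ring x) ⟩
    by-fours (x + + 2) n ++ by-fours (x + + 2 + + 2) n  ↭⟨ interleave (x + + 2) n ⟩
    run (x + + 2) (n ℕ.+ n)                             ∎)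
    where
    open PermutationReasoning
    ring : ∀ x → x + + 4 ≡ x + + 2 + + 2
    ring = solve-∀

  -- One parity class of the positive x in a Kotzig array: when x grows by 2, the entry 2x grows by
  -- 4 and the other two fall by 2 each, which keeps the row sum.
  triples : ℤ → ℤ → ℤ → ℕ → List Triple
  triples x y z zero    = []
  triples x y z (suc n) = (x , y , z) ∷ triples (x + + 4) (y - + 2) (z - + 2) n

  length-triples : ∀ x y z n → length (triples x y z n) ≡ n
  length-triples x y z zero    = refl
  length-triples x y z (suc n) = cong suc (length-triples _ _ _ n)

  triples-zero : ∀ x y z n → x + (y + (z + + 0)) ≡ + 0 → All (λ t → Σℤ ⟦ t ⟧ ≡ + 0) (triples x y z n)
  triples-zero x y z zero    e = []
  triples-zero x y z (suc n) e = e ∷ triples-zero _ _ _ n (trans (ring x y z) e)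
    where
    ring : ∀ x y z → x + + 4 + (y - + 2 + (z - + 2 + + 0)) ≡ x + (y + (z + + 0))
    ring = solve-∀

  -- Up to sign all columns ascend: the second entries are read backwards, the third ones are
  -- negated, which `±` permits.
  ±-triples : ∀ x y z n → ± (entries (triples x y z n)) ↭ ± (by-fours x n ++ run (y + + 2 - + 2 * + n) n ++ run (- z) n)
  ±-triples x y z n = begin
    ± (entries (triples x y z n))
      ↭⟨ ±-↭ (↭-sym (columns-↭ (triples x y z n))) ⟩
    ± (map c₁ ts ++ map c₂ ts ++ map c₃ ts ++ [])
      ≡⟨ cong ± (cong₂ _++_ (first x y z n) (cong₂ _++_ (second x y z n) (trans (++-identityʳ _) (third x y z n)))) ⟩
    ± (by-fours x n ++ down y n ++ down z n)
      ↭⟨ ↭-trans (±-++ (by-fours x n) (down y n ++ down z n)) (++⁺ˡ (± (by-fours x n)) (±-++ (down y n) (down z n))) ⟩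
    ± (by-fours x n) ++ ± (down y n) ++ ± (down z n)
      ↭⟨ ++⁺ˡ (± (by-fours x n)) (++⁺ down-y down-z) ⟩
    ± (by-fours x n) ++ ± (run (y + + 2 - + 2 * + n) n) ++ ± (run (- z) n)
      ↭⟨ ↭-trans (±-++ (by-fours x n) _) (++⁺ˡ (± (by-fours x n)) (±-++ (run (y + + 2 - + 2 * + n) n) (run (- z) n))) ⟨
    ± (by-fours x n ++ run (y + + 2 - + 2 * + n) n ++ run (- z) n) ∎
    where
    open PermutationReasoning
    ts : List Triple
    ts = triples x y z n
    first : ∀ x y z n → map c₁ (triples x y z n) ≡ by-fours x n
    first x y z zero    = refl
    first x y z (suc n) = cong (x ∷_) (first _ _ _ n)
    second : ∀ x y z n → map c₂ (triples x y z n) ≡ down y n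
    second x y z zero    = refl
    second x y z (suc n) = cong (y ∷_) (second _ _ _ n)
    third : ∀ x y z n → map c₃ (triples x y z n) ≡ down z n
    third x y z zero    = refl
    third x y z (suc n) = cong (z ∷_) (third _ _ _ n)
    ring : ∀ y n → + 2 - (- y) - + 2 * n ≡ y + + 2 - + 2 * n
    ring = solve-∀
    down-y : ± (down y n) ↭ ± (run (y + + 2 - + 2 * + n) n)
    down-y = ±-↭ (↭-trans (↭-reflexive (down-≡ y n))
      (↭-trans (neg-run (- y) n) (↭-reflexive (run-≡ {n = n} (ring y (+ n)) refl))))
    down-z : ± (down z n) ↭ ± (run (- z) n)
    down-z = ↭-trans (±-↭ (↭-reflexive (down-≡ z n))) (±-neg (run (- z) n))

  -- The exchanged rows are the first two of the first family and the first of the second. Within a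
  -- family y - x drops by 6 from row to row, so the condition of `threeColumns` reduces to y₂ - x₂
  -- + 6 = u.
  kotzigRows : ∀ u x₁ y₁ z₁ x₂ y₂ z₂ n₁ n₂ → x₁ + (y₁ + (z₁ + + 0)) ≡ + 0 → x₂ + (y₂ + (z₂ + + 0)) ≡ + 0 →
    y₂ - x₂ + + 6 ≡ u →
    ZeroSum (suc ((suc (suc n₁) ℕ.+ suc n₂) ℕ.* 2)) 3
      ([ + 0 ] ++ ± ([ u ] ++ entries (triples x₁ y₁ z₁ (suc (suc n₁))) ++ entries (triples x₂ y₂ z₂ (suc n₂))))
  kotzigRows u x₁ y₁ z₁ x₂ y₂ z₂ n₁ n₂ e₁ e₂ D 
    with triples-zero x₁ y₁ z₁ (suc (suc n₁)) e₁ | triples-zero x₂ y₂ z₂ (suc n₂) e₂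
  ... | a₁ ∷ a₃ ∷ as | a₂ ∷ bs = subst (λ m → ZeroSum m 3 ([ + 0 ] ++ ± ([ u ] ++ (a ++ c ++ entries ts₁) ++ b ++ entries ts₂))) (cong (λ k → suc (k ℕ.* 2)) len)
    (zeroSum-↭ (↭-prep (+ 0) (±-↭ (↭-prep u p)))
    (threeColumns u x₁ y₁ z₁ x₂ y₂ z₂ (x₁ + + 4) (y₁ - + 2) (z₁ - + 2) (ts₁ ++ ts₂) (a₁ ∷ a₂ ∷ a₃ ∷ All-++⁺ as bs)
      (trans (ring x₁ y₁ x₂ y₂) (cong (λ v → v + ((y₁ - + 2) - (x₁ + + 4))) D))))
    where
    ring : ∀ x₁ y₁ x₂ y₂ → (y₁ - x₁) + (y₂ - x₂) ≡ y₂ - x₂ + + 6 + ((y₁ - + 2) - (x₁ + + 4))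
    ring = solve-∀
    ts₁ ts₂ : List Triple
    ts₁ = triples (x₁ + + 4 + + 4) (y₁ - + 2 - + 2) (z₁ - + 2 - + 2) n₁
    ts₂ = triples (x₂ + + 4) (y₂ - + 2) (z₂ - + 2) n₂
    len : 3 ℕ.+ length (ts₁ ++ ts₂) ≡ suc (suc n₁) ℕ.+ suc n₂
    len rewrite length-++ ts₁ {ts₂} | length-triples (x₁ + + 4 + + 4) (y₁ - + 2 - + 2) (z₁ - + 2 - + 2) n₁
              | length-triples (x₂ + + 4) (y₂ - + 2) (z₂ - + 2) n₂ = cong (2 ℕ.+_) (sym (ℕₚ.+-suc n₁ n₂))
    a b c : List ℤ
    a = ⟦ x₁ , y₁ , z₁ ⟧
    b = ⟦ x₂ , y₂ , z₂ ⟧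
    c = ⟦ x₁ + + 4 , y₁ - + 2 , z₁ - + 2 ⟧
    p : a ++ b ++ c ++ entries (ts₁ ++ ts₂) ↭ (a ++ c ++ entries ts₁) ++ b ++ entries ts₂
    p = ↭-trans (↭-reflexive (cong (λ l → a ++ b ++ c ++ l) (concatMap-++ ⟦_⟧ ts₁ ts₂)))
      (++-solve 5 (λ a b c d e → a ⊕ (b ⊕ (c ⊕ (d ⊕ e))) ⊜ (a ⊕ (c ⊕ d)) ⊕ (b ⊕ e)) ↭-refl a b c (entries ts₁) (entries ts₂))

  ±-kotzig : ∀ u x₁ y₁ z₁ x₂ y₂ z₂ n₁ n₂ →
    ± ([ u ] ++ entries (triples x₁ y₁ z₁ n₁) ++ entries (triples x₂ y₂ z₂ n₂)) ↭
    ± ([ u ] ++ (by-fours x₁ n₁ ++ run (y₁ + + 2 - + 2 * + n₁) n₁ ++ run (- z₁) n₁)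
             ++ (by-fours x₂ n₂ ++ run (y₂ + + 2 - + 2 * + n₂) n₂ ++ run (- z₂) n₂))
  ±-kotzig u x₁ y₁ z₁ x₂ y₂ z₂ n₁ n₂ = begin
    ± ([ u ] ++ E₁ ++ E₂)
      ↭⟨ ↭-trans (±-++ [ u ] _) (++⁺ˡ (± [ u ]) (±-++ E₁ E₂)) ⟩
    ± [ u ] ++ ± E₁ ++ ± E₂
      ↭⟨ ++⁺ˡ (± [ u ]) (++⁺ (±-triples x₁ y₁ z₁ n₁) (±-triples x₂ y₂ z₂ n₂)) ⟩
    ± [ u ] ++ ± F₁ ++ ± F₂
      ↭⟨ ↭-trans (±-++ [ u ] _) (++⁺ˡ (± [ u ]) (±-++ F₁ F₂)) ⟨
    ± ([ u ] ++ F₁ ++ F₂) ∎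
    where
    open PermutationReasoning
    E₁ E₂ F₁ F₂ : List ℤ
    E₁ = entries (triples x₁ y₁ z₁ n₁)
    E₂ = entries (triples x₂ y₂ z₂ n₂)
    F₁ = by-fours x₁ n₁ ++ run (y₁ + + 2 - + 2 * + n₁) n₁ ++ run (- z₁) n₁
    F₂ = by-fours x₂ n₂ ++ run (y₂ + + 2 - + 2 * + n₂) n₂ ++ run (- z₂) n₂

  halve : ∀ n → ∃ λ h → n ≡ h ℕ.+ h ⊎ n ≡ suc (h ℕ.+ h)
  halve zero = 0 , inj₁ refl
  halve (suc n) with halve n
  ... | h , inj₁ refl = h , inj₂ refl
  ... | h , inj₂ refl = suc h , inj₁ (cong suc (sym (ℕₚ.+-suc h h)))

  run-merge : ∀ {a b} m n → a + + 2 * + m ≡ b → run a m ++ run b n ≡ run a (m ℕ.+ n)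
  run-merge {a} m n refl = sym (run-++ a m n)

  -- With u a permutation of -p, …, p such that x + u(x) = u(-x), the rows of the array are (2x , c + 2u(x) , -(c + 2u(-x)))
  -- for x = -p, …, p. For p = 2h take u(2a) = -h - a and u(2a - 1) = h + 1 - a; for p = 2h + 1 take u(2a) = h + 1 - a
  -- and u(2a - 1) = -h - a.
  Base : ℕ → ℤ → Set
  Base p c = ZeroSum (suc (p ℕ.* 2)) 3 ([ + 0 ] ++ ± (run (+ 2) p ++ run (c - + 2 * + p) (suc (p ℕ.* 2))))

  base-even : ∀ k c → Base (suc (suc k) ℕ.+ suc (suc k)) c
  base-even k c = zeroSum-↭ (↭-prep (+ 0) (↭-trans (±-kotzig u x₁ y₁ z₁ x₂ y₂ z₂ h h) (±-↭ p)))
    (kotzigRows u x₁ y₁ z₁ x₂ y₂ z₂ k (suc k) (ring₁ c (+ h)) (ring₂ c (+ h)) (ring₃ c (+ h)))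
    where
    h : ℕ
    h = suc (suc k)
    u x₁ y₁ z₁ x₂ y₂ z₂ : ℤ
    -- The rows of x = 0, 1, 2: here u(0) = -h, u(1) = h, u(2) = -h - 1, and the third entries come
    -- from u(-1) = h + 1 and u(-2) = 1 - h.
    u  = c - + 2 * + h
    x₁ = + 2
    y₁ = c + + 2 * + h
    z₁ = - (c + + 2 * + h + + 2)
    x₂ = + 4
    y₂ = c - + 2 * + h - + 2
    z₂ = - (c - + 2 * + h + + 2)
    ring₁ : ∀ c h → + 2 + (c + + 2 * h + (- (c + + 2 * h + + 2) + + 0)) ≡ + 0
    ring₁ = solve-∀
    ring₂ : ∀ c h → + 4 + (c - + 2 * h - + 2 + (- (c - + 2 * h + + 2) + + 0)) ≡ + 0
    ring₂ = solve-∀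
    ring₃ : ∀ c h → c - + 2 * h - + 2 - + 4 + + 6 ≡ c - + 2 * h
    ring₃ = solve-∀
    r₁ : ∀ c h → c - + 2 * h - + 2 + + 2 - + 2 * h ≡ c - + 2 * (h + h)
    r₁ = solve-∀
    r₂ : ∀ c h → c - + 2 * (h + h) + + 2 * h ≡ c - + 2 * h
    r₂ = solve-∀
    r₃ : ∀ c h → c - + 2 * (h + h) + + 2 * (h + + 1) ≡ - (- (c - + 2 * h + + 2))
    r₃ = solve-∀
    r₄ : ∀ c h → c - + 2 * (h + h) + + 2 * (h + + 1 + h) ≡ c + + 2 * h + + 2 - + 2 * h
    r₄ = solve-∀
    r₅ : ∀ c h → c - + 2 * (h + h) + + 2 * (h + + 1 + h + h) ≡ - (- (c + + 2 * h + + 2))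
    r₅ = solve-∀
    n-eq : ∀ h → h ℕ.+ 1 ℕ.+ h ℕ.+ h ℕ.+ h ≡ suc ((h ℕ.+ h) ℕ.* 2)
    n-eq = ℕSolver.solve-∀
    open PermutationReasoning
    p : [ u ] ++ (by-fours x₁ h ++ run (y₁ + + 2 - + 2 * + h) h ++ run (- z₁) h)
              ++ (by-fours x₂ h ++ run (y₂ + + 2 - + 2 * + h) h ++ run (- z₂) h)
        ↭ run (+ 2) (h ℕ.+ h) ++ run (c - + 2 * + (h ℕ.+ h)) (suc ((h ℕ.+ h) ℕ.* 2))
    p = begin
      [ u ] ++ (by-fours x₁ h ++ run (y₁ + + 2 - + 2 * + h) h ++ run (- z₁) h)
            ++ (by-fours x₂ h ++ run (y₂ + + 2 - + 2 * + h) h ++ run (- z₂) h)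
        -- In increasing order, the values c + 2u(x) come from even x > 0, x = 0, even x < 0, odd x
        -- > 0, odd x < 0; the five pieces are contiguous.
        ↭⟨ ++-solve 7 (λ u x₁ y₁ z₁ x₂ y₂ z₂ → u ⊕ ((x₁ ⊕ (y₁ ⊕ z₁)) ⊕ (x₂ ⊕ (y₂ ⊕ z₂))) ⊜
              (x₁ ⊕ x₂) ⊕ ((((y₂ ⊕ u) ⊕ z₂) ⊕ y₁) ⊕ z₁)) ↭-refl [ u ] (by-fours x₁ h) (run (y₁ + + 2 - + 2 * + h) h) (run (- z₁) h)
              (by-fours x₂ h) (run (y₂ + + 2 - + 2 * + h) h) (run (- z₂) h) ⟩
      (by-fours x₁ h ++ by-fours x₂ h) ++
        (((run (y₂ + + 2 - + 2 * + h) h ++ [ u ]) ++ run (- z₂) h) ++ run (y₁ + + 2 - + 2 * + h) h) ++ run (- z₁) h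
        ↭⟨ ++⁺ (interleave (+ 2) h) (↭-reflexive q) ⟩
      run (+ 2) (h ℕ.+ h) ++ run (c - + 2 * + (h ℕ.+ h)) (suc ((h ℕ.+ h) ℕ.* 2)) ∎
      where
      L : ℤ
      L = c - + 2 * + (h ℕ.+ h)
      q : (((run (y₂ + + 2 - + 2 * + h) h ++ run u 1) ++ run (- z₂) h) ++ run (y₁ + + 2 - + 2 * + h) h) ++ run (- z₁) h
          ≡ run L (suc ((h ℕ.+ h) ℕ.* 2))
      q = trans (cong (λ a → (((run a h ++ run u 1) ++ run (- z₂) h) ++ run (y₁ + + 2 - + 2 * + h) h) ++ run (- z₁) h) (r₁ c (+ h)))
         (trans (cong (λ l → ((l ++ run (- z₂) h) ++ run (y₁ + + 2 - + 2 * + h) h) ++ run (- z₁) h) (run-merge h 1 (r₂ c (+ h))))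
         (trans (cong (λ l → (l ++ run (y₁ + + 2 - + 2 * + h) h) ++ run (- z₁) h) (run-merge (h ℕ.+ 1) h (r₃ c (+ h))))
         (trans (cong (λ l → l ++ run (- z₁) h) (run-merge (h ℕ.+ 1 ℕ.+ h) h (r₄ c (+ h))))
         (trans (run-merge (h ℕ.+ 1 ℕ.+ h ℕ.+ h) h (r₅ c (+ h))) (run-≡ {L} refl (n-eq h))))))

  base-odd : ∀ k c → Base (suc (suc k) ℕ.+ suc k) c
  base-odd k c = zeroSum-↭ (↭-prep (+ 0) (↭-trans (±-kotzig u x₁ y₁ z₁ x₂ y₂ z₂ (suc h) h) (±-↭ p)))
    (kotzigRows u x₁ y₁ z₁ x₂ y₂ z₂ k k (ring₁ c (+ h)) (ring₂ c (+ h)) (ring₃ c (+ h)))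
    where
    h : ℕ
    h = suc k
    u x₁ y₁ z₁ x₂ y₂ z₂ : ℤ
    -- Now u(0) = h + 1, u(1) = -h - 1, u(2) = h, u(-1) = -h and u(-2) = h + 2. The pieces ascend in
    -- the order odd x > 0, odd x < 0, even x > 0, x = 0, even x < 0.
    u  = c + + 2 * + h + + 2
    x₁ = + 2
    y₁ = c - + 2 * + h - + 2
    z₁ = - (c - + 2 * + h)
    x₂ = + 4
    y₂ = c + + 2 * + h
    z₂ = - (c + + 2 * + h + + 4)
    ring₁ : ∀ c h → + 2 + (c - + 2 * h - + 2 + (- (c - + 2 * h) + + 0)) ≡ + 0
    ring₁ = solve-∀
    ring₂ : ∀ c h → + 4 + (c + + 2 * h + (- (c + + 2 * h + + 4) + + 0)) ≡ + 0
    ring₂ = solve-∀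
    ring₃ : ∀ c h → c + + 2 * h - + 4 + + 6 ≡ c + + 2 * h + + 2
    ring₃ = solve-∀
    r₁ : ∀ c h → c - + 2 * h - + 2 + + 2 - + 2 * (+ 1 + h) ≡ c - + 2 * (+ 1 + h + h)
    r₁ = solve-∀
    r₂ : ∀ c h → c - + 2 * (+ 1 + h + h) + + 2 * (+ 1 + h) ≡ - (- (c - + 2 * h))
    r₂ = solve-∀
    r₃ : ∀ c h → c - + 2 * (+ 1 + h + h) + + 2 * (+ 1 + h + (+ 1 + h)) ≡ c + + 2 * h + + 2 - + 2 * h
    r₃ = solve-∀
    r₄ : ∀ c h → c - + 2 * (+ 1 + h + h) + + 2 * (+ 1 + h + (+ 1 + h) + h) ≡ c + + 2 * h + + 2
    r₄ = solve-∀
    r₅ : ∀ c h → c - + 2 * (+ 1 + h + h) + + 2 * (+ 1 + h + (+ 1 + h) + h + + 1) ≡ - (- (c + + 2 * h + + 4))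
    r₅ = solve-∀
    n-eq : ∀ h → suc h ℕ.+ suc h ℕ.+ h ℕ.+ 1 ℕ.+ h ≡ suc ((suc h ℕ.+ h) ℕ.* 2)
    n-eq = ℕSolver.solve-∀
    open PermutationReasoning
    p : [ u ] ++ (by-fours x₁ (suc h) ++ run (y₁ + + 2 - + 2 * + suc h) (suc h) ++ run (- z₁) (suc h))
              ++ (by-fours x₂ h ++ run (y₂ + + 2 - + 2 * + h) h ++ run (- z₂) h)
        ↭ run (+ 2) (suc h ℕ.+ h) ++ run (c - + 2 * + (suc h ℕ.+ h)) (suc ((suc h ℕ.+ h) ℕ.* 2))
    p = begin
      [ u ] ++ (by-fours x₁ (suc h) ++ run (y₁ + + 2 - + 2 * + suc h) (suc h) ++ run (- z₁) (suc h))
            ++ (by-fours x₂ h ++ run (y₂ + + 2 - + 2 * + h) h ++ run (- z₂) h)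
        ↭⟨ ++-solve 7 (λ u x₁ y₁ z₁ x₂ y₂ z₂ → u ⊕ ((x₁ ⊕ (y₁ ⊕ z₁)) ⊕ (x₂ ⊕ (y₂ ⊕ z₂))) ⊜
              (x₁ ⊕ x₂) ⊕ ((((y₁ ⊕ z₁) ⊕ y₂) ⊕ u) ⊕ z₂)) ↭-refl [ u ] (by-fours x₁ (suc h)) (run (y₁ + + 2 - + 2 * + suc h) (suc h))
              (run (- z₁) (suc h)) (by-fours x₂ h) (run (y₂ + + 2 - + 2 * + h) h) (run (- z₂) h) ⟩
      (by-fours x₁ (suc h) ++ by-fours x₂ h) ++
        (((run (y₁ + + 2 - + 2 * + suc h) (suc h) ++ run (- z₁) (suc h)) ++ run (y₂ + + 2 - + 2 * + h) h) ++ [ u ]) ++ run (- z₂) h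
        ↭⟨ ++⁺ (interleave-suc (+ 2) h) (↭-reflexive q) ⟩
      run (+ 2) (suc h ℕ.+ h) ++ run (c - + 2 * + (suc h ℕ.+ h)) (suc ((suc h ℕ.+ h) ℕ.* 2)) ∎
      where
      L : ℤ
      L = c - + 2 * + (suc h ℕ.+ h)
      q : (((run (y₁ + + 2 - + 2 * + suc h) (suc h) ++ run (- z₁) (suc h)) ++ run (y₂ + + 2 - + 2 * + h) h) ++ run u 1) ++ run (- z₂) h
          ≡ run L (suc ((suc h ℕ.+ h) ℕ.* 2))
      q = trans (cong (λ a → (((run a (suc h) ++ run (- z₁) (suc h)) ++ run (y₂ + + 2 - + 2 * + h) h) ++ run u 1) ++ run (- z₂) h) (r₁ c (+ h)))
         (trans (cong (λ l → ((l ++ run (y₂ + + 2 - + 2 * + h) h) ++ run u 1) ++ run (- z₂) h) (run-merge (suc h) (suc h) (r₂ c (+ h))))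
         (trans (cong (λ l → (l ++ run u 1) ++ run (- z₂) h) (run-merge (suc h ℕ.+ suc h) h (r₃ c (+ h))))
         (trans (cong (λ l → l ++ run (- z₂) h) (run-merge (suc h ℕ.+ suc h ℕ.+ h) 1 (r₄ c (+ h))))
         (trans (run-merge (suc h ℕ.+ suc h ℕ.+ h ℕ.+ 1) h (r₅ c (+ h))) (run-≡ {L} refl (n-eq h))))))

  -- The exchange in `threeColumns` takes three pairs of opposite rows, hence p ≥ 3.
  base : ∀ p c → 3 ℕ.≤ p → Base p c
  base p c 3≤p with ℕₚ.m≤n⇒∃[o]m+o≡n 3≤p
  ... | k , refl with halve k
  ...   | j , inj₁ refl = subst (λ p → Base p c) (eq j) (base-odd j c)
    where
    eq : ∀ j → suc (suc j) ℕ.+ suc j ≡ 3 ℕ.+ (j ℕ.+ j)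
    eq = ℕSolver.solve-∀
  ...   | j , inj₂ refl = subst (λ p → Base p c) (eq j) (base-even j c)
    where
    eq : ∀ j → suc (suc j) ℕ.+ suc (suc j) ≡ 3 ℕ.+ suc (j ℕ.+ j)
    eq = ℕSolver.solve-∀

  -- Pairs of opposite columns of odd height

  -- With (p² + p)/2 as the parameter of `balanced`, a run of 2p values has the total -2p; every
  -- further unit subtracts 4.
  tri : ℕ → ℕ
  tri zero    = 0
  tri (suc n) = suc n ℕ.+ tri n

  tri+tri : ∀ n → sq n ℕ.+ n ≡ tri n ℕ.+ tri n
  tri+tri zero    = refl
  tri+tri (suc n) = trans (eq₁ n) (trans (cong (ℕ._+ (suc n ℕ.+ suc n)) (tri+tri n)) (eq₂ n (tri n)))
    where
    eq₁ : ∀ n → suc n ℕ.* suc n ℕ.+ suc n ≡ n ℕ.* n ℕ.+ n ℕ.+ (suc n ℕ.+ suc n)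
    eq₁ = ℕSolver.solve-∀
    eq₂ : ∀ n t → t ℕ.+ t ℕ.+ (suc n ℕ.+ suc n) ≡ suc n ℕ.+ t ℕ.+ (suc n ℕ.+ t)
    eq₂ = ℕSolver.solve-∀

  tri≤sq : ∀ n → tri n ℕ.≤ sq n
  tri≤sq zero    = z≤n
  tri≤sq (suc n) = ℕₚ.+-monoʳ-≤ (suc n) (ℕₚ.≤-trans (tri≤sq n) (ℕₚ.*-monoʳ-≤ n (ℕₚ.n≤1+n n)))

  -- A block of 2n values can therefore compensate every single of index i < n.
  tri+i≤sq : ∀ {i n} → i ℕ.< n → tri n ℕ.+ i ℕ.≤ sq n
  tri+i≤sq {i} {suc n} (s≤s i≤n) = begin
    suc n ℕ.+ tri n ℕ.+ i    ≤⟨ ℕₚ.+-mono-≤ (ℕₚ.+-monoʳ-≤ (suc n) (tri≤sq n)) i≤n ⟩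
    suc n ℕ.+ sq n ℕ.+ n     ≡⟨ eq n ⟩
    suc n ℕ.* suc n          ∎
    where
    open ℕₚ.≤-Reasoning
    eq : ∀ n → suc n ℕ.+ n ℕ.* n ℕ.+ n ≡ suc n ℕ.* suc n
    eq = ℕSolver.solve-∀

  -- A column of height 2p + 1 consists of one value 2z and of 2p further values, signed in pairs. For a run of 2p values
  -- half the signed sum has the parity of p; the value 2z is right if z has that parity, and wrong otherwise.
  rightValue wrongValue : ℕ → ℕ → ℤ
  rightValue p i = + 2 * (+ p + + 2 * + i)
  wrongValue p i = + 2 * (+ 1 + + p + + 2 * + i)

  height : ℕ → ℕ
  height p = suc (p ℕ.+ p)

  rightColumn : ∀ p i a → tri p ℕ.+ i ℕ.≤ sq p → Pairs (height p) 1 ([ rightValue p i ] ++ run a (p ℕ.+ p))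
  rightColumn p i a bound = one (cong suc (run-length a (p ℕ.+ p)))
    (signed-≡ (ring (+ sq p) (+ p) (+ tri p) (+ i) (cong +_ (tri+tri p)))
      (signed-++ (signed-single (rightValue p i)) (balanced p a (tri p ℕ.+ i) bound)))
    where
    ring′ : ∀ s p t i → + 2 * (p + + 2 * i) + (+ 2 * s - + 4 * (t + i)) ≡ + 2 * (s + p) - + 2 * (t + t)
    ring′ = solve-∀
    cancel : ∀ d → + 2 * d - + 2 * d ≡ + 0
    cancel = solve-∀
    ring : ∀ s p t i → s + p ≡ t + t → + 2 * (p + + 2 * i) + (+ 2 * s - + 4 * (t + i)) ≡ + 0
    ring s p t i e = trans (ring′ s p t i) (trans (cong (λ d → + 2 * d - + 2 * (t + t)) e) (cancel (t + t)))

  -- One pair of the block is at distance 4, an even half-difference 2, and the remaining 2q values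
  -- have a half-sum of the parity of q. The whole block thus has the parity opposite to that of p =
  -- q + 1, as the wrong single requires.
  wrongColumn : ∀ q i x a → tri q ℕ.+ i ℕ.≤ sq q →
    Pairs (height (suc q)) 1 ([ wrongValue (suc q) i ] ++ (x ∷ x + + 4 ∷ []) ++ run a (q ℕ.+ q))
  wrongColumn q i x a bound = one (trans (cong (3 ℕ.+_) (run-length a (q ℕ.+ q))) (eq q))
    (signed-≡ (ring x (+ sq q) (+ q) (+ tri q) (+ i) (cong +_ (tri+tri q)))
      (signed-++ (signed-single (wrongValue (suc q) i))
        (signed-++ (signed-neg (signed-pair x (x + + 4))) (balanced q a (tri q ℕ.+ i) bound))))
    where
    eq : ∀ q → 3 ℕ.+ (q ℕ.+ q) ≡ suc (suc q ℕ.+ suc q)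
    eq = ℕSolver.solve-∀
    ring′ : ∀ x s q t i → + 2 * (+ 1 + (+ 1 + q) + + 2 * i) + (- (x + + 4 - x) + (+ 2 * s - + 4 * (t + i))) ≡ + 2 * (s + q) - + 2 * (t + t)
    ring′ = solve-∀
    cancel : ∀ d → + 2 * d - + 2 * d ≡ + 0
    cancel = solve-∀
    ring : ∀ x s q t i → s + q ≡ t + t →
      + 2 * (+ 1 + (+ 1 + q) + + 2 * i) + (- (x + + 4 - x) + (+ 2 * s - + 4 * (t + i))) ≡ + 0
    ring x s q t i e = trans (ring′ x s q t i) (trans (cong (λ d → + 2 * d - + 2 * (t + t)) e) (cancel (t + t)))

  -- Two consecutive blocks of even length with their neighbouring end elements exchanged; this changes
  -- the parity of both block sums.
  exchange : ∀ q a → let b = a + + 2 * + (q ℕ.+ q) in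
    run a (suc q ℕ.+ suc q ℕ.+ (suc q ℕ.+ suc q)) ↭
    ((b ∷ b + + 4 ∷ []) ++ run a (q ℕ.+ q)) ++ ((b + + 2 ∷ b + + 2 + + 4 ∷ []) ++ run (b + + 8) (q ℕ.+ q))
  exchange q a = begin
    run a (suc q ℕ.+ suc q ℕ.+ (suc q ℕ.+ suc q))
      ≡⟨ run-≡ {a} refl (eq q) ⟩
    run a (q ℕ.+ q ℕ.+ (4 ℕ.+ (q ℕ.+ q)))
      ≡⟨ trans (run-++ a (q ℕ.+ q) _) (cong (run a (q ℕ.+ q) ++_) (run-++ b 4 (q ℕ.+ q))) ⟩
    run a (q ℕ.+ q) ++ run b 4 ++ run (b + + 8) (q ℕ.+ q)
      ≡⟨ cong₂ (λ y z → run a (q ℕ.+ q) ++ (b ∷ b + + 2 ∷ y ∷ z ∷ []) ++ run (b + + 8) (q ℕ.+ q)) (ring₁ b) (ring₂ b) ⟩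
    run a (q ℕ.+ q) ++ (b ∷ b + + 2 ∷ b + + 4 ∷ b + + 2 + + 4 ∷ []) ++ run (b + + 8) (q ℕ.+ q)
      ↭⟨ ++-solve 6 (λ r x y z w s → r ⊕ ((x ⊕ (y ⊕ (z ⊕ w))) ⊕ s) ⊜ ((x ⊕ z) ⊕ r) ⊕ ((y ⊕ w) ⊕ s)) ↭-refl
           (run a (q ℕ.+ q)) [ b ] [ b + + 2 ] [ b + + 4 ] [ b + + 2 + + 4 ] (run (b + + 8) (q ℕ.+ q)) ⟩
    ((b ∷ b + + 4 ∷ []) ++ run a (q ℕ.+ q)) ++ ((b + + 2 ∷ b + + 2 + + 4 ∷ []) ++ run (b + + 8) (q ℕ.+ q)) ∎
    where
    open PermutationReasoning
    b : ℤ
    b = a + + 2 * + (q ℕ.+ q)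
    eq : ∀ q → suc q ℕ.+ suc q ℕ.+ (suc q ℕ.+ suc q) ≡ q ℕ.+ q ℕ.+ (4 ℕ.+ (q ℕ.+ q))
    eq = ℕSolver.solve-∀
    ring₁ : ∀ b → b + + 2 + + 2 ≡ b + + 4
    ring₁ = solve-∀
    ring₂ : ∀ b → b + + 2 + + 2 + + 2 ≡ b + + 2 + + 4
    ring₂ = solve-∀

  -- Three consecutive singles are wrong, right, wrong: the two wrong ones share an exchange of two
  -- blocks, and the right one takes an ordinary third block.
  threeSingles : ∀ q i a → suc i ℕ.< q →
    Pairs (height (suc q)) 3 (run (wrongValue (suc q) i) 3 ++ run a (3 ℕ.* (suc q ℕ.+ suc q)))
  threeSingles q i a i<q = permₚ p
    ((wrongColumn q i b a (tri+i≤sq (ℕₚ.<⇒≤ i<q)) ⊎ₚ wrongColumn q (suc i) (b + + 2) (b + + 8) (tri+i≤sq i<q)) ⊎ₚ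
     rightColumn (suc q) (suc i) c (tri+i≤sq (ℕₚ.m<n⇒m<1+n i<q)))
    where
    B : ℕ
    B = suc q ℕ.+ suc q
    b c w : ℤ
    b = a + + 2 * + (q ℕ.+ q)
    c = a + + 2 * + (B ℕ.+ B)
    w = wrongValue (suc q) i
    ring₁ : ∀ q i → + 2 * (+ 1 + q + + 2 * i) + + 2 ≡ + 2 * (q + + 2 * (+ 1 + i))
    ring₁ = solve-∀
    ring₂ : ∀ q i → + 2 * (+ 1 + q + + 2 * i) + + 2 + + 2 ≡ + 2 * (+ 1 + q + + 2 * (+ 1 + i))
    ring₂ = solve-∀
    eq : ∀ n → n ℕ.+ (n ℕ.+ (n ℕ.+ 0)) ≡ n ℕ.+ n ℕ.+ n
    eq = ℕSolver.solve-∀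
    open PermutationReasoning
    p : (([ w ] ++ (b ∷ b + + 4 ∷ []) ++ run a (q ℕ.+ q)) ++
         ([ wrongValue (suc q) (suc i) ] ++ (b + + 2 ∷ b + + 2 + + 4 ∷ []) ++ run (b + + 8) (q ℕ.+ q))) ++
        ([ rightValue (suc q) (suc i) ] ++ run c B)
        ↭ run w 3 ++ run a (3 ℕ.* B)
    p = begin
      (([ w ] ++ (b ∷ b + + 4 ∷ []) ++ run a (q ℕ.+ q)) ++
       ([ wrongValue (suc q) (suc i) ] ++ (b + + 2 ∷ b + + 2 + + 4 ∷ []) ++ run (b + + 8) (q ℕ.+ q))) ++
      ([ rightValue (suc q) (suc i) ] ++ run c B)
        ↭⟨ ++-solve 6 (λ w x v y u r → ((w ⊕ x) ⊕ (v ⊕ y)) ⊕ (u ⊕ r) ⊜ (w ⊕ (u ⊕ v)) ⊕ ((x ⊕ y) ⊕ r)) ↭-refl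
             [ w ] ((b ∷ b + + 4 ∷ []) ++ run a (q ℕ.+ q)) [ wrongValue (suc q) (suc i) ]
             ((b + + 2 ∷ b + + 2 + + 4 ∷ []) ++ run (b + + 8) (q ℕ.+ q)) [ rightValue (suc q) (suc i) ] (run c B) ⟩
      (w ∷ rightValue (suc q) (suc i) ∷ wrongValue (suc q) (suc i) ∷ []) ++
        ((((b ∷ b + + 4 ∷ []) ++ run a (q ℕ.+ q)) ++ ((b + + 2 ∷ b + + 2 + + 4 ∷ []) ++ run (b + + 8) (q ℕ.+ q))) ++ run c B)
        ↭⟨ ++⁺ (↭-reflexive (cong₂ (λ y z → w ∷ y ∷ z ∷ []) (sym (ring₁ (+ suc q) (+ i))) (sym (ring₂ (+ suc q) (+ i)))))
               (++⁺ʳ (run c B) (↭-sym (exchange q a))) ⟩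
      run w 3 ++ (run a (B ℕ.+ B) ++ run c B)
        ≡⟨ cong (run w 3 ++_) (trans (run-merge (B ℕ.+ B) B refl) (run-≡ {a} refl (sym (eq B)))) ⟩
      run w 3 ++ run a (3 ℕ.* B) ∎

  rightColumn-≡ : ∀ p i v a → v ≡ rightValue p i → tri p ℕ.+ i ℕ.≤ sq p → Pairs (height p) 1 ([ v ] ++ run a (p ℕ.+ p))
  rightColumn-≡ p i v a refl = rightColumn p i a

  fourSingles : ∀ q i a → suc (suc i) ℕ.< q →
    Pairs (height (suc q)) 4 (run (wrongValue (suc q) i) 4 ++ run a (4 ℕ.* (suc q ℕ.+ suc q)))
  fourSingles q i a i<q = permₚ p
    (threeSingles q i a (ℕₚ.<⇒≤ i<q) ⊎ₚ
     rightColumn-≡ (suc q) (suc (suc i)) (w + + 6) c (ring (+ suc q) (+ i)) (tri+i≤sq (ℕₚ.m<n⇒m<1+n i<q)))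
    where
    B : ℕ
    B = suc q ℕ.+ suc q
    c w : ℤ
    c = a + + 2 * + (3 ℕ.* B)
    w = wrongValue (suc q) i
    ring : ∀ q i → + 2 * (+ 1 + q + + 2 * i) + + 6 ≡ + 2 * (q + + 2 * (+ 1 + (+ 1 + i)))
    ring = solve-∀
    eq : ∀ n → n ℕ.+ (n ℕ.+ (n ℕ.+ 0)) ℕ.+ n ≡ n ℕ.+ (n ℕ.+ (n ℕ.+ (n ℕ.+ 0)))
    eq = ℕSolver.solve-∀
    open PermutationReasoning
    p : (run w 3 ++ run a (3 ℕ.* B)) ++ ([ w + + 6 ] ++ run c B) ↭ run w 4 ++ run a (4 ℕ.* B)
    p = begin
      (run w 3 ++ run a (3 ℕ.* B)) ++ ([ w + + 6 ] ++ run c B)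
        ↭⟨ ++-solve 4 (λ w x y z → (w ⊕ x) ⊕ (y ⊕ z) ⊜ (w ⊕ y) ⊕ (x ⊕ z)) ↭-refl (run w 3) (run a (3 ℕ.* B)) [ w + + 6 ] (run c B) ⟩
      (run w 3 ++ [ w + + 6 ]) ++ (run a (3 ℕ.* B) ++ run c B)
        ≡⟨ cong₂ _++_ (sym (run-∷ʳ w 3)) (trans (run-merge (3 ℕ.* B) B refl) (run-≡ {a} refl (eq B))) ⟩
      run w 4 ++ run a (4 ℕ.* B) ∎

  -- Four consecutive singles raise the index i by 2 and lead back to a wrong value, so the pattern
  -- can be repeated.
  manySingles : ∀ j q i a → i ℕ.+ (j ℕ.+ j) ℕ.< q →
    Pairs (height (suc q)) (j ℕ.* 4) (run (wrongValue (suc q) i) (j ℕ.* 4) ++ run a (j ℕ.* (4 ℕ.* (suc q ℕ.+ suc q))))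
  manySingles zero    q i a i<q = none
  manySingles (suc j) q i a i<q = permₚ p
    (fourSingles q i a (ℕₚ.≤-<-trans (ℕₚ.≤-trans (ℕₚ.m≤m+n (2 ℕ.+ i) (j ℕ.+ j)) (ℕₚ.≤-reflexive (eq i j))) i<q) ⊎ₚ
     manySingles j q (suc (suc i)) c (subst (ℕ._< q) (sym (eq i j)) i<q))
    where
    eq : ∀ i j → 2 ℕ.+ i ℕ.+ (j ℕ.+ j) ≡ i ℕ.+ (suc j ℕ.+ suc j)
    eq = ℕSolver.solve-∀
    B : ℕ
    B = 4 ℕ.* (suc q ℕ.+ suc q)
    c w : ℤ
    c = a + + 2 * + B
    w = wrongValue (suc q) i
    ring : ∀ q i → + 2 * (+ 1 + q + + 2 * i) + + 8 ≡ + 2 * (+ 1 + q + + 2 * (+ 1 + (+ 1 + i)))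
    ring = solve-∀
    open PermutationReasoning
    w′ : ℤ
    w′ = wrongValue (suc q) (suc (suc i))
    p : (run w 4 ++ run a B) ++ (run w′ (j ℕ.* 4) ++ run c (j ℕ.* B)) ↭ run w (suc j ℕ.* 4) ++ run a (suc j ℕ.* B)
    p = begin
      (run w 4 ++ run a B) ++ (run w′ (j ℕ.* 4) ++ run c (j ℕ.* B))
        ↭⟨ ++-solve 4 (λ w x y z → (w ⊕ x) ⊕ (y ⊕ z) ⊜ (w ⊕ y) ⊕ (x ⊕ z)) ↭-refl (run w 4) (run a B) (run w′ (j ℕ.* 4)) (run c (j ℕ.* B)) ⟩
      (run w 4 ++ run w′ (j ℕ.* 4)) ++ (run a B ++ run c (j ℕ.* B))
        ≡⟨ cong₂ _++_ (run-merge 4 (j ℕ.* 4) (ring (+ suc q) (+ i))) (run-merge B (j ℕ.* B) refl) ⟩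
      run w (suc j ℕ.* 4) ++ run a (suc j ℕ.* B) ∎

  -- One level is missing between the two runs; the jump across it corrects the parity for the wrong value.
  straddle : ∀ r i i′ a → let q = suc (suc r) ; p = suc q in
    i ℕ.≤ r → i′ ℕ.< p →
    Pairs (height p) 2 ((wrongValue p i ∷ rightValue p i′ ∷ []) ++
      run a (suc (q ℕ.+ q)) ++ run (a + + 2 * + (suc (q ℕ.+ q) ℕ.+ height p)) (height p))
  straddle r i i′ a i≤r i′<p = permₚ perm′ (one len sig ⊎ₚ rightColumn p i′ (f + + 2) (tri+i≤sq i′<p))
    where
    q p : ℕ
    q = suc (suc r)
    p = suc q
    f l : ℤ
    f = a + + 2 * + (suc (q ℕ.+ q) ℕ.+ height p)
    l = a + + 2 * + (q ℕ.+ q)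
    -- The pair across the gap contributes -(4p + 4). A vanishing total then asks for the parameter
    -- (q² - q - 2)/2 + i, which is tri r + r + i since q = r + 2.
    bound : tri r ℕ.+ r ℕ.+ i ℕ.≤ sq q
    bound = begin
      tri r ℕ.+ r ℕ.+ i        ≤⟨ ℕₚ.+-mono-≤ (ℕₚ.+-monoˡ-≤ r (tri≤sq r)) i≤r ⟩
      sq r ℕ.+ r ℕ.+ r         ≤⟨ ℕₚ.m≤m+n _ (r ℕ.+ r ℕ.+ 4) ⟩
      sq r ℕ.+ r ℕ.+ r ℕ.+ (r ℕ.+ r ℕ.+ 4) ≡⟨ eq r ⟩
      sq q ∎
      where
      open ℕₚ.≤-Reasoning
      eq : ∀ r → r ℕ.* r ℕ.+ r ℕ.+ r ℕ.+ (r ℕ.+ r ℕ.+ 4) ≡ suc (suc r) ℕ.* suc (suc r)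
      eq = ℕSolver.solve-∀
    len : length ([ wrongValue p i ] ++ (l ∷ f ∷ []) ++ run a (q ℕ.+ q)) ≡ height p
    len = trans (cong (3 ℕ.+_) (run-length a (q ℕ.+ q))) (eq q)
      where
      eq : ∀ q → 3 ℕ.+ (q ℕ.+ q) ≡ suc (suc q ℕ.+ suc q)
      eq = ℕSolver.solve-∀
    ring′ : ∀ a r s t i → let q = + 1 + (+ 1 + r) in
      + 2 * (+ 1 + (+ 1 + q) + + 2 * i) +
        (- (a + + 2 * (+ 1 + (q + q) + (+ 1 + (+ 1 + q + (+ 1 + q)))) - (a + + 2 * (q + q))) +
        (+ 2 * (s + r + r + (r + r + + 4)) - + 4 * (t + r + i))) ≡ + 2 * (s + r) - + 2 * (t + t)
    ring′ = solve-∀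
    cancel : ∀ d → + 2 * d - + 2 * d ≡ + 0
    cancel = solve-∀
    ring : ∀ a r s t i {S} → s + r ≡ t + t → S ≡ s + r + r + (r + r + + 4) → let q = + 1 + (+ 1 + r) in
      + 2 * (+ 1 + (+ 1 + q) + + 2 * i) +
        (- (a + + 2 * (+ 1 + (q + q) + (+ 1 + (+ 1 + q + (+ 1 + q)))) - (a + + 2 * (q + q))) +
        (+ 2 * S - + 4 * (t + r + i))) ≡ + 0
    ring a r s t i e refl = trans (ring′ a r s t i) (trans (cong (λ d → + 2 * d - + 2 * (t + t)) e) (cancel (t + t)))
    sig : Signed ([ wrongValue p i ] ++ (l ∷ f ∷ []) ++ run a (q ℕ.+ q)) (+ 0)
    sig = signed-≡ (ring a (+ r) (+ sq r) (+ tri r) (+ i) (cong +_ (tri+tri r)) (cong +_ (eq r)))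
      (signed-++ (signed-single (wrongValue p i))
        (signed-++ (signed-neg (signed-pair l f)) (balanced q a (tri r ℕ.+ r ℕ.+ i) bound)))
      where
      eq : ∀ r → suc (suc r) ℕ.* suc (suc r) ≡ r ℕ.* r ℕ.+ r ℕ.+ r ℕ.+ (r ℕ.+ r ℕ.+ 4)
      eq = ℕSolver.solve-∀
    open PermutationReasoning
    perm′ : ([ wrongValue p i ] ++ (l ∷ f ∷ []) ++ run a (q ℕ.+ q)) ++ ([ rightValue p i′ ] ++ run (f + + 2) (p ℕ.+ p))
      ↭ (wrongValue p i ∷ rightValue p i′ ∷ []) ++ run a (suc (q ℕ.+ q)) ++ run f (height p)
    perm′ = begin
      ([ wrongValue p i ] ++ (l ∷ f ∷ []) ++ run a (q ℕ.+ q)) ++ ([ rightValue p i′ ] ++ run (f + + 2) (p ℕ.+ p))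
        ↭⟨ ++-solve 6 (λ w l f r v s → (w ⊕ ((l ⊕ f) ⊕ r)) ⊕ (v ⊕ s) ⊜ (w ⊕ v) ⊕ ((r ⊕ l) ⊕ (f ⊕ s))) ↭-refl
             [ wrongValue p i ] [ l ] [ f ] (run a (q ℕ.+ q)) [ rightValue p i′ ] (run (f + + 2) (p ℕ.+ p)) ⟩
      (wrongValue p i ∷ rightValue p i′ ∷ []) ++ (run a (q ℕ.+ q) ++ [ l ]) ++ run f (height p)
        ≡⟨ cong (λ z → (wrongValue p i ∷ rightValue p i′ ∷ []) ++ z ++ run f (height p)) (sym (run-∷ʳ a (q ℕ.+ q))) ⟩
      (wrongValue p i ∷ rightValue p i′ ∷ []) ++ run a (suc (q ℕ.+ q)) ++ run f (height p) ∎

  -- Arrays with an odd number of rows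

  same-sort : ∀ {xs ys} → sort xs ≡ sort ys → xs ↭ ys
  same-sort {xs} {ys} e = ↭-trans (↭-sym (sort-↭ xs)) (↭-trans (↭-reflexive e) (sort-↭ ys))

  base-height : ∀ p c → 3 ℕ.≤ p → ZeroSum (height p) 3 ([ + 0 ] ++ ± (run (+ 2) p ++ run (c - + 2 * + p) (height p)))
  base-height p c 3≤p = subst (λ n → ZeroSum (suc n) 3 ([ + 0 ] ++ ± (run (+ 2) p ++ run (c - + 2 * + p) (suc n)))) (eq p) (base p c 3≤p)
    where
    eq : ∀ p → p ℕ.* 2 ≡ p ℕ.+ p
    eq = ℕSolver.solve-∀

  -- The positive centred labels are shared out: the p smallest and the `height p` consecutive ones
  -- from c on supply the three special columns, and S supplies the pairs. `Base` starts its long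
  -- run at its parameter minus 2p, hence the argument c + 2p.
  assemble : ∀ p {k X S} c → 3 ℕ.≤ p → Pairs (height p) k S → run (+ 2) p ++ S ++ run c (height p) ↭ run (+ 2) X →
    ZeroSum (height p) (k ℕ.* 2 ℕ.+ 3) ([ + 0 ] ++ ± (run (+ 2) X))
  assemble p {k} {X} {S} c 3≤p P q = zeroSum-↭ r (fill P (base-height p (c + + 2 * + p) 3≤p))
    where
    open PermutationReasoning
    ring : ∀ c p → c + + 2 * p - + 2 * p ≡ c
    ring = solve-∀
    D L : List ℤ
    D = run (+ 2) p
    L = run c (height p)
    r : ± S ++ [ + 0 ] ++ ± (D ++ run (c + + 2 * + p - + 2 * + p) (height p)) ↭ [ + 0 ] ++ ± (run (+ 2) X)
    r = begin
      ± S ++ [ + 0 ] ++ ± (D ++ run (c + + 2 * + p - + 2 * + p) (height p))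
        ≡⟨ cong (λ z → ± S ++ [ + 0 ] ++ ± (D ++ run z (height p))) (ring c (+ p)) ⟩
      ± S ++ [ + 0 ] ++ ± (D ++ L)
        ↭⟨ ++-solve 3 (λ s o d → s ⊕ (o ⊕ d) ⊜ o ⊕ (s ⊕ d)) ↭-refl (± S) [ + 0 ] (± (D ++ L)) ⟩
      [ + 0 ] ++ ± S ++ ± (D ++ L)
        ↭⟨ ↭-prep (+ 0) (↭-sym (±-++ S (D ++ L))) ⟩
      [ + 0 ] ++ ± (S ++ D ++ L)
        ↭⟨ ↭-prep (+ 0) (±-↭ (↭-trans (++-solve 3 (λ s d l → s ⊕ (d ⊕ l) ⊜ d ⊕ (s ⊕ l)) ↭-refl S D L) q)) ⟩
      [ + 0 ] ++ ± (run (+ 2) X) ∎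

  levelRing : ∀ p → + 2 + + 2 * p ≡ + 2 * (+ 1 + p + + 2 * + 0)
  levelRing = solve-∀

  topLevel : ∀ p {k} n → 3 ℕ.≤ p → Pairs (height p) k (run (wrongValue p 0) n) →
    ZeroSum (height p) (k ℕ.* 2 ℕ.+ 3) ([ + 0 ] ++ ± (run (+ 2) (p ℕ.+ (n ℕ.+ height p))))
  topLevel p n 3≤p P = assemble p (w + + 2 * + n) 3≤p P (↭-reflexive
    (trans (cong (run (+ 2) p ++_) (run-merge n (height p) refl)) (run-merge p (n ℕ.+ height p) (levelRing (+ p)))))
    where
    w : ℤ
    w = wrongValue p 0

  -- The reserved level lies second from the top; the run above it gives a block something to jump
  -- to, or provides a single of the other parity.
  belowTop : ∀ p {k} n → 3 ℕ.≤ p →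
    Pairs (height p) k (run (wrongValue p 0) n ++ run (wrongValue p 0 + + 2 * + (n ℕ.+ height p)) (height p)) →
    ZeroSum (height p) (k ℕ.* 2 ℕ.+ 3) ([ + 0 ] ++ ± (run (+ 2) (p ℕ.+ (n ℕ.+ height p ℕ.+ height p))))
  belowTop p n 3≤p P = assemble p (w + + 2 * + n) 3≤p P (begin
    run (+ 2) p ++ (run w n ++ run f m) ++ run (w + + 2 * + n) m
      ↭⟨ ++⁺ˡ (run (+ 2) p) (++-solve 3 (λ a b c → (a ⊕ b) ⊕ c ⊜ (a ⊕ c) ⊕ b) ↭-refl (run w n) (run f m) (run (w + + 2 * + n) m)) ⟩
    run (+ 2) p ++ (run w n ++ run (w + + 2 * + n) m) ++ run f m
      ≡⟨ cong (run (+ 2) p ++_) (trans (cong (_++ run f m) (run-merge n m refl)) (run-merge (n ℕ.+ m) m refl)) ⟩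
    run (+ 2) p ++ run w (n ℕ.+ m ℕ.+ m)
      ≡⟨ run-merge p (n ℕ.+ m ℕ.+ m) (levelRing (+ p)) ⟩
    run (+ 2) (p ℕ.+ (n ℕ.+ m ℕ.+ m)) ∎)
    where
    open PermutationReasoning
    m : ℕ
    m = height p
    w f : ℤ
    w = wrongValue p 0
    f = w + + 2 * + (n ℕ.+ m)

  -- For N = (2p + 1)(2b + 1) the centred labels are the even numbers of absolute value at most N -
  -- 1 = 2(p + (2p + 1)b).
  Odd : ℕ → ℕ → Set
  Odd p b = ZeroSum (height p) (suc (b ℕ.+ b)) ([ + 0 ] ++ ± (run (+ 2) (p ℕ.+ height p ℕ.* b)))

  toOdd : ∀ {p X} k b → k ℕ.* 2 ℕ.+ 3 ≡ suc (b ℕ.+ b) → X ≡ p ℕ.+ height p ℕ.* b →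
    ZeroSum (height p) (k ℕ.* 2 ℕ.+ 3) ([ + 0 ] ++ ± (run (+ 2) X)) → Odd p b
  toOdd {p} k b e refl = subst (λ s → ZeroSum (height p) s ([ + 0 ] ++ ± (run (+ 2) (p ℕ.+ height p ℕ.* b)))) e

  -- For a concrete matrix the sums are decided by evaluation, and the entries are compared after
  -- sorting, so that `refl` suffices.
  fromMatrix : ∀ {m s xs} (M : Vec (Vec ℤ s) m) → let e = λ i j → Vec.lookup (Vec.lookup M i) j in
    {True (all? λ i → Σℤ (tabulate (e i)) ≟ℤ + 0)} → {True (all? λ j → Σℤ (tabulate λ i → e i j) ≟ℤ + 0)} →
    sort (concat (tabulate λ j → tabulate λ i → e i j)) ≡ sort xs → ZeroSum m s xs
  fromMatrix M {r} {c} p = record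
    { entry = λ i j → Vec.lookup (Vec.lookup M i) j ; row-sum = toWitness r ; col-sum = toWitness c ; perm = same-sort p }

  -- The two cases in which the signed sums are too small; the matrices were found by computer search.
  odd-5×3 : Odd 2 1
  odd-5×3 = fromMatrix
    ((- (+ 10) ∷ - (+ 4) ∷ + 14 ∷ []) ∷
     (- (+ 12) ∷ + 4 ∷ + 8 ∷ []) ∷
     (+ 10 ∷ - (+ 8) ∷ - (+ 2) ∷ []) ∷
     (+ 0 ∷ + 6 ∷ - (+ 6) ∷ []) ∷
     (+ 12 ∷ + 2 ∷ - (+ 14) ∷ []) ∷ [])
    refl

  odd-7×5 : Odd 3 2
  odd-7×5 = fromMatrix
    ((- (+ 24) ∷ + 14 ∷ + 16 ∷ + 8 ∷ - (+ 14) ∷ []) ∷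
     (+ 10 ∷ + 6 ∷ - (+ 8) ∷ - (+ 30) ∷ + 22 ∷ []) ∷
     (- (+ 4) ∷ - (+ 12) ∷ - (+ 2) ∷ + 34 ∷ - (+ 16) ∷ []) ∷
     (+ 0 ∷ - (+ 26) ∷ + 18 ∷ + 28 ∷ - (+ 20) ∷ []) ∷
     (+ 20 ∷ - (+ 18) ∷ - (+ 22) ∷ - (+ 10) ∷ + 30 ∷ []) ∷
     (+ 26 ∷ + 12 ∷ - (+ 34) ∷ + 2 ∷ - (+ 6) ∷ []) ∷
     (- (+ 28) ∷ + 24 ∷ + 32 ∷ - (+ 32) ∷ + 4 ∷ []) ∷ [])
    refl

  -- The three special columns are the whole array; for p = 2 there are too few rows to exchange.
  odd-1 : ∀ p → 1 ℕ.< p → Odd p 1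
  odd-1 (suc zero) (s≤s ())
  odd-1 2 _ = odd-5×3
  odd-1 p@(suc (suc (suc _))) _ = toOdd {p} 0 1 refl (cong (p ℕ.+_) (sym (ℕₚ.*-identityʳ (height p))))
    (topLevel p 0 (s≤s (s≤s (s≤s z≤n))) none)

  -- A lone single right above the p smallest values would be wrong. Moving the reserved level down
  -- raises it by 2(2p + 1), an odd multiple of 2, and so makes it right. Its size then requires tri
  -- p + p + 1 ≤ p², which holds from p = 4 on.
  odd-2 : ∀ p → 2 ℕ.< p → Odd p 2
  odd-2 (suc zero) (s≤s ())
  odd-2 (suc (suc zero)) (s≤s (s≤s ()))
  odd-2 3 _ = odd-7×5
  odd-2 p@(suc (suc (suc (suc r)))) _ = toOdd {p} 1 2 refl (cong (p ℕ.+_) (eq (height p)))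
    (belowTop p 0 (s≤s (s≤s (s≤s z≤n)))
      (rightColumn-≡ p (suc p) (wrongValue p 0 + + 2 * + height p) _ (ring (+ p)) bound))
    where
    eq : ∀ m → m ℕ.+ m ≡ m ℕ.* 2
    eq = ℕSolver.solve-∀
    ring : ∀ p → + 2 * (+ 1 + p + + 2 * + 0) + + 2 * (+ 1 + (p + p)) ≡ + 2 * (p + + 2 * (+ 1 + p))
    ring = solve-∀
    bound : tri p ℕ.+ suc p ℕ.≤ sq p
    bound = begin
      tri p ℕ.+ suc p                                              ≡⟨ eq₁ r (tri r) ⟩
      tri r ℕ.+ r ℕ.+ (r ℕ.* 4 ℕ.+ 15)                             ≤⟨ ℕₚ.+-monoˡ-≤ _ (ℕₚ.+-monoˡ-≤ r (tri≤sq r)) ⟩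
      sq r ℕ.+ r ℕ.+ (r ℕ.* 4 ℕ.+ 15)                              ≤⟨ ℕₚ.m≤m+n _ (r ℕ.* 3 ℕ.+ 1) ⟩
      sq r ℕ.+ r ℕ.+ (r ℕ.* 4 ℕ.+ 15) ℕ.+ (r ℕ.* 3 ℕ.+ 1)          ≡⟨ eq₂ r ⟩
      sq p                                                         ∎
      where
      open ℕₚ.≤-Reasoning
      eq₁ : ∀ r t → suc (suc (suc (suc r))) ℕ.+ (suc (suc (suc r)) ℕ.+ (suc (suc r) ℕ.+ (suc r ℕ.+ t))) ℕ.+ suc (suc (suc (suc (suc r))))
            ≡ t ℕ.+ r ℕ.+ (r ℕ.* 4 ℕ.+ 15)
      eq₁ = ℕSolver.solve-∀
      eq₂ : ∀ r → r ℕ.* r ℕ.+ r ℕ.+ (r ℕ.* 4 ℕ.+ 15) ℕ.+ (r ℕ.* 3 ℕ.+ 1) ≡ suc (suc (suc (suc r))) ℕ.* suc (suc (suc (suc r)))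
      eq₂ = ℕSolver.solve-∀

  2j≤4j : ∀ j → j ℕ.+ j ℕ.≤ j ℕ.* 4
  2j≤4j j = ℕₚ.≤-trans (ℕₚ.m≤m+n (j ℕ.+ j) (j ℕ.+ j)) (ℕₚ.≤-reflexive (eq j))
    where
    eq : ∀ j → j ℕ.+ j ℕ.+ (j ℕ.+ j) ≡ j ℕ.* 4
    eq = ℕSolver.solve-∀

  -- There are K = b - 1 singles, starting with a wrong one, so half of K, rounded up, are wrong.
  -- This number is even for K = 4j + 3 and 4j + 4; it is odd for K = 4j + 2 and 4j + 5, where
  -- `straddle` absorbs the last wrong single together with a right one.
  module OddLarge (r : ℕ) where

    q p B m : ℕ
    q = suc (suc r)
    p = suc q
    B = p ℕ.+ p
    m = height p

    w : ℤ
    w = wrongValue p 0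

    3≤p : 3 ℕ.≤ p
    3≤p = s≤s (s≤s (s≤s z≤n))

    odd-4j+3 : ∀ j → j ℕ.* 4 ℕ.+ 2 ℕ.≤ suc r → Odd p (suc (j ℕ.* 4 ℕ.+ 2))
    odd-4j+3 j h = toOdd {p} K (suc K) (eq₁ K) (cong (p ℕ.+_) (eq₂ j q))
      (belowTop p n 3≤p (permₚ perm′ (manySingles j q 0 a (s≤s (ℕₚ.≤-trans j+j≤r (ℕₚ.n≤1+n r))) ⊎ₚ
        straddle r (j ℕ.+ j) (suc (j ℕ.+ j)) a′ j+j≤r (s≤s (s≤s (ℕₚ.≤-trans j+j≤r (ℕₚ.n≤1+n r)))))))
      where
      K n : ℕ
      K = j ℕ.* 4 ℕ.+ 2
      n = K ℕ.+ (j ℕ.* (4 ℕ.* B) ℕ.+ suc (q ℕ.+ q))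
      a a′ : ℤ
      a  = w + + 2 * + K
      a′ = a + + 2 * + (j ℕ.* (4 ℕ.* B))
      j+j≤r : j ℕ.+ j ℕ.≤ r
      j+j≤r = ℕₚ.≤-trans (2j≤4j j) (ℕₚ.≤-trans (ℕₚ.m≤m+n _ 1) (ℕₚ.≤-pred (ℕₚ.≤-trans (ℕₚ.≤-reflexive (sym (ℕₚ.+-suc (j ℕ.* 4) 1))) h)))
      eq₁ : ∀ K → K ℕ.* 2 ℕ.+ 3 ≡ suc (suc K ℕ.+ suc K)
      eq₁ = ℕSolver.solve-∀
      eq₂ : ∀ j q → let p = suc q ; B = p ℕ.+ p ; K = j ℕ.* 4 ℕ.+ 2 in
        K ℕ.+ (j ℕ.* (4 ℕ.* B) ℕ.+ suc (q ℕ.+ q)) ℕ.+ suc B ℕ.+ suc B ≡ suc B ℕ.* suc K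
      eq₂ = ℕSolver.solve-∀
      ring₁ : ∀ p j → + 2 * (+ 1 + p + + 2 * + 0) + + 2 * (j * + 4) ≡ + 2 * (+ 1 + p + + 2 * (j + j))
      ring₁ = solve-∀
      ring₂ : ∀ p j → + 2 * (+ 1 + p + + 2 * (j + j)) + + 2 ≡ + 2 * (p + + 2 * (+ 1 + (j + j)))
      ring₂ = solve-∀
      ring₃ : ∀ w K x y m → w + + 2 * K + + 2 * x + + 2 * (y + m) ≡ w + + 2 * (K + (x + y) + m)
      ring₃ = solve-∀
      open PermutationReasoning
      perm′ : (run w (j ℕ.* 4) ++ run a (j ℕ.* (4 ℕ.* B))) ++ ((wrongValue p (j ℕ.+ j) ∷ rightValue p (suc (j ℕ.+ j)) ∷ []) ++
                run a′ (suc (q ℕ.+ q)) ++ run (a′ + + 2 * + (suc (q ℕ.+ q) ℕ.+ m)) m)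
              ↭ run w n ++ run (w + + 2 * + (n ℕ.+ m)) m
      perm′ = begin
        (run w (j ℕ.* 4) ++ run a (j ℕ.* (4 ℕ.* B))) ++ ((wrongValue p (j ℕ.+ j) ∷ rightValue p (suc (j ℕ.+ j)) ∷ []) ++
                run a′ (suc (q ℕ.+ q)) ++ run (a′ + + 2 * + (suc (q ℕ.+ q) ℕ.+ m)) m)
          ↭⟨ ++-solve 5 (λ x y z u v → (x ⊕ y) ⊕ (z ⊕ (u ⊕ v)) ⊜ ((x ⊕ z) ⊕ (y ⊕ u)) ⊕ v) ↭-refl (run w (j ℕ.* 4)) (run a (j ℕ.* (4 ℕ.* B)))
               (wrongValue p (j ℕ.+ j) ∷ rightValue p (suc (j ℕ.+ j)) ∷ []) (run a′ (suc (q ℕ.+ q))) (run (a′ + + 2 * + (suc (q ℕ.+ q) ℕ.+ m)) m) ⟩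
        ((run w (j ℕ.* 4) ++ (wrongValue p (j ℕ.+ j) ∷ rightValue p (suc (j ℕ.+ j)) ∷ [])) ++ (run a (j ℕ.* (4 ℕ.* B)) ++ run a′ (suc (q ℕ.+ q))))
          ++ run (a′ + + 2 * + (suc (q ℕ.+ q) ℕ.+ m)) m
          ≡⟨ cong₂ _++_ (trans (cong₂ _++_
               (trans (cong (λ v → run w (j ℕ.* 4) ++ (wrongValue p (j ℕ.+ j) ∷ v ∷ [])) (sym (ring₂ (+ p) (+ j))))
                 (run-merge (j ℕ.* 4) 2 (trans (cong (λ z → w + + 2 * z) (pos-* j 4)) (ring₁ (+ p) (+ j)))))
               (run-merge (j ℕ.* (4 ℕ.* B)) (suc (q ℕ.+ q)) refl)) (run-merge K _ refl))
               (cong (λ z → run z m) (ring₃ w (+ K) (+ (j ℕ.* (4 ℕ.* B))) (+ suc (q ℕ.+ q)) (+ m))) ⟩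
        run w n ++ run (w + + 2 * + (n ℕ.+ m)) m ∎

    odd-4j+4 : ∀ j → j ℕ.* 4 ℕ.+ 3 ℕ.≤ suc r → Odd p (suc (j ℕ.* 4 ℕ.+ 3))
    odd-4j+4 j h = toOdd {p} K (suc K) (eq₁ K) (cong (p ℕ.+_) (eq₂ j q))
      (topLevel p n 3≤p (permₚ perm′ (manySingles j q 0 a (s≤s (ℕₚ.≤-trans j+j≤r (ℕₚ.n≤1+n r))) ⊎ₚ
        threeSingles q (j ℕ.+ j) a′ (s≤s (s≤s j+j≤r)))))
      where
      K n : ℕ
      K = j ℕ.* 4 ℕ.+ 3
      n = K ℕ.+ (j ℕ.* (4 ℕ.* B) ℕ.+ 3 ℕ.* B)
      a a′ : ℤ
      a  = w + + 2 * + K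
      a′ = a + + 2 * + (j ℕ.* (4 ℕ.* B))
      j+j≤r : j ℕ.+ j ℕ.≤ r
      j+j≤r = ℕₚ.≤-trans (2j≤4j j) (ℕₚ.≤-trans (ℕₚ.m≤m+n _ 2) (ℕₚ.≤-pred (ℕₚ.≤-trans (ℕₚ.≤-reflexive (sym (ℕₚ.+-suc (j ℕ.* 4) 2))) h)))
      eq₁ : ∀ K → K ℕ.* 2 ℕ.+ 3 ≡ suc (suc K ℕ.+ suc K)
      eq₁ = ℕSolver.solve-∀
      eq₂ : ∀ j q → let p = suc q ; B = p ℕ.+ p ; K = j ℕ.* 4 ℕ.+ 3 in
        K ℕ.+ (j ℕ.* (4 ℕ.* B) ℕ.+ 3 ℕ.* B) ℕ.+ suc B ≡ suc B ℕ.* suc K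
      eq₂ = ℕSolver.solve-∀
      ring₁ : ∀ p j → + 2 * (+ 1 + p + + 2 * + 0) + + 2 * (j * + 4) ≡ + 2 * (+ 1 + p + + 2 * (j + j))
      ring₁ = solve-∀
      open PermutationReasoning
      perm′ : (run w (j ℕ.* 4) ++ run a (j ℕ.* (4 ℕ.* B))) ++ (run (wrongValue p (j ℕ.+ j)) 3 ++ run a′ (3 ℕ.* B)) ↭ run w n
      perm′ = begin
        (run w (j ℕ.* 4) ++ run a (j ℕ.* (4 ℕ.* B))) ++ (run (wrongValue p (j ℕ.+ j)) 3 ++ run a′ (3 ℕ.* B))
          ↭⟨ ++-solve 4 (λ x y z u → (x ⊕ y) ⊕ (z ⊕ u) ⊜ (x ⊕ z) ⊕ (y ⊕ u)) ↭-refl (run w (j ℕ.* 4)) (run a (j ℕ.* (4 ℕ.* B)))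
               (run (wrongValue p (j ℕ.+ j)) 3) (run a′ (3 ℕ.* B)) ⟩
        (run w (j ℕ.* 4) ++ run (wrongValue p (j ℕ.+ j)) 3) ++ (run a (j ℕ.* (4 ℕ.* B)) ++ run a′ (3 ℕ.* B))
          ≡⟨ trans (cong₂ _++_ (run-merge (j ℕ.* 4) 3 (trans (cong (λ z → w + + 2 * z) (pos-* j 4)) (ring₁ (+ p) (+ j))))
               (run-merge (j ℕ.* (4 ℕ.* B)) (3 ℕ.* B) refl)) (run-merge K _ refl) ⟩
        run w n ∎

    odd-4j+5 : ∀ j → suc j ℕ.* 4 ℕ.≤ suc r → Odd p (suc (suc j ℕ.* 4))
    odd-4j+5 j h = toOdd {p} K (suc K) (eq₁ K) (cong (p ℕ.+_) (eq₂ (suc j) q))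
      (topLevel p n 3≤p (permₚ (↭-reflexive (run-merge K _ refl)) (manySingles (suc j) q 0 (w + + 2 * + K)
        (s≤s (ℕₚ.≤-trans (2j≤4j (suc j)) h)))))
      where
      K n : ℕ
      K = suc j ℕ.* 4
      n = K ℕ.+ suc j ℕ.* (4 ℕ.* B)
      eq₁ : ∀ K → K ℕ.* 2 ℕ.+ 3 ≡ suc (suc K ℕ.+ suc K)
      eq₁ = ℕSolver.solve-∀
      eq₂ : ∀ j q → let p = suc q ; B = p ℕ.+ p ; K = j ℕ.* 4 in
        K ℕ.+ j ℕ.* (4 ℕ.* B) ℕ.+ suc B ≡ suc B ℕ.* suc K
      eq₂ = ℕSolver.solve-∀

    odd-4j+6 : ∀ j → j ℕ.* 4 ℕ.+ 5 ℕ.≤ suc r → Odd p (suc (j ℕ.* 4 ℕ.+ 5))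
    odd-4j+6 j h = toOdd {p} K (suc K) (eq₁ K) (cong (p ℕ.+_) (eq₂ j q))
      (belowTop p n 3≤p (permₚ perm′ (pairs-≡ (ℕₚ.+-assoc (j ℕ.* 4) 3 2) ((manySingles j q 0 a (s≤s (ℕₚ.≤-trans j+j≤r (ℕₚ.n≤1+n r))) ⊎ₚ
        threeSingles q (j ℕ.+ j) a′ (s≤s (s≤s j+j≤r))) ⊎ₚ
        -- Of the last two singles the right one is now the smaller, so both carry the same index.
        straddle r i i a″ i≤r (s≤s (ℕₚ.≤-trans i≤r (ℕₚ.≤-trans (ℕₚ.n≤1+n r) (ℕₚ.n≤1+n (suc r)))))))))
      where
      K n i : ℕ
      K = j ℕ.* 4 ℕ.+ 5
      n = K ℕ.+ (j ℕ.* (4 ℕ.* B) ℕ.+ 3 ℕ.* B ℕ.+ suc (q ℕ.+ q))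
      i = 2 ℕ.+ (j ℕ.+ j)
      a a′ a″ : ℤ
      a  = w + + 2 * + K
      a′ = a + + 2 * + (j ℕ.* (4 ℕ.* B))
      a″ = a + + 2 * + (j ℕ.* (4 ℕ.* B) ℕ.+ 3 ℕ.* B)
      i≤r : i ℕ.≤ r
      i≤r = ℕₚ.≤-trans (ℕₚ.+-monoʳ-≤ 2 (2j≤4j j)) (ℕₚ.≤-trans (ℕₚ.m≤n+m _ 2)
        (ℕₚ.≤-pred (ℕₚ.≤-trans (ℕₚ.≤-reflexive (ℕₚ.+-comm 5 (j ℕ.* 4))) h)))
      j+j≤r : j ℕ.+ j ℕ.≤ r
      j+j≤r = ℕₚ.≤-trans (ℕₚ.m≤n+m _ 2) i≤r
      eq₁ : ∀ K → K ℕ.* 2 ℕ.+ 3 ≡ suc (suc K ℕ.+ suc K)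
      eq₁ = ℕSolver.solve-∀
      eq₂ : ∀ j q → let p = suc q ; B = p ℕ.+ p ; K = j ℕ.* 4 ℕ.+ 5 in
        K ℕ.+ (j ℕ.* (4 ℕ.* B) ℕ.+ 3 ℕ.* B ℕ.+ suc (q ℕ.+ q)) ℕ.+ suc B ℕ.+ suc B ≡ suc B ℕ.* suc K
      eq₂ = ℕSolver.solve-∀
      ring₁ : ∀ p j → + 2 * (+ 1 + p + + 2 * + 0) + + 2 * (j * + 4) ≡ + 2 * (+ 1 + p + + 2 * (j + j))
      ring₁ = solve-∀
      ring₂ : ∀ p j → + 2 * (+ 1 + p + + 2 * + 0) + + 2 * (j * + 4 + + 3) ≡ + 2 * (p + + 2 * (+ 2 + (j + j)))
      ring₂ = solve-∀
      ring₄ : ∀ p j → + 2 * (p + + 2 * (+ 2 + (j + j))) + + 2 ≡ + 2 * (+ 1 + p + + 2 * (+ 2 + (j + j)))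
      ring₄ = solve-∀
      ring₃ : ∀ w K x y m → w + + 2 * K + + 2 * x + + 2 * (y + m) ≡ w + + 2 * (K + (x + y) + m)
      ring₃ = solve-∀
      open PermutationReasoning
      W R : ℤ
      W = wrongValue p i
      R = rightValue p i
      f : ℤ
      f = a″ + + 2 * + (suc (q ℕ.+ q) ℕ.+ m)
      singles : (run w (j ℕ.* 4) ++ run (wrongValue p (j ℕ.+ j)) 3) ++ (R ∷ W ∷ []) ≡ run w K
      singles = trans (cong₂ _++_ (run-merge (j ℕ.* 4) 3 (trans (cong (λ z → w + + 2 * z) (pos-* j 4)) (ring₁ (+ p) (+ j))))
                  (cong (λ z → R ∷ z ∷ []) (sym (ring₄ (+ p) (+ j)))))
                (trans (run-merge (j ℕ.* 4 ℕ.+ 3) 2 (trans (cong (λ z → w + + 2 * (z + + 3)) (pos-* j 4)) (ring₂ (+ p) (+ j))))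
                  (run-≡ {w} refl (ℕₚ.+-assoc (j ℕ.* 4) 3 2)))
      perm′ : ((run w (j ℕ.* 4) ++ run a (j ℕ.* (4 ℕ.* B))) ++ (run (wrongValue p (j ℕ.+ j)) 3 ++ run a′ (3 ℕ.* B))) ++
              ((W ∷ R ∷ []) ++ run a″ (suc (q ℕ.+ q)) ++ run f m)
              ↭ run w n ++ run (w + + 2 * + (n ℕ.+ m)) m
      perm′ = begin
        ((run w (j ℕ.* 4) ++ run a (j ℕ.* (4 ℕ.* B))) ++ (run (wrongValue p (j ℕ.+ j)) 3 ++ run a′ (3 ℕ.* B))) ++
              ((W ∷ R ∷ []) ++ run a″ (suc (q ℕ.+ q)) ++ run f m)
          ↭⟨ ++-solve 8 (λ x y z u c d v g → ((x ⊕ y) ⊕ (z ⊕ u)) ⊕ ((c ⊕ d) ⊕ (v ⊕ g)) ⊜ (((x ⊕ z) ⊕ (d ⊕ c)) ⊕ ((y ⊕ u) ⊕ v)) ⊕ g) ↭-refl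
               (run w (j ℕ.* 4)) (run a (j ℕ.* (4 ℕ.* B))) (run (wrongValue p (j ℕ.+ j)) 3) (run a′ (3 ℕ.* B)) [ W ] [ R ]
               (run a″ (suc (q ℕ.+ q))) (run f m) ⟩
        (((run w (j ℕ.* 4) ++ run (wrongValue p (j ℕ.+ j)) 3) ++ (R ∷ W ∷ [])) ++
          ((run a (j ℕ.* (4 ℕ.* B)) ++ run a′ (3 ℕ.* B)) ++ run a″ (suc (q ℕ.+ q)))) ++ run f m
          ≡⟨ cong₂ _++_ (trans (cong₂ _++_ singles
               (trans (cong (_++ run a″ (suc (q ℕ.+ q))) (run-merge (j ℕ.* (4 ℕ.* B)) (3 ℕ.* B) refl))
                      (run-merge (j ℕ.* (4 ℕ.* B) ℕ.+ 3 ℕ.* B) (suc (q ℕ.+ q)) refl)))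
               (run-merge K _ refl))
               (cong (λ z → run z m) (ring₃ w (+ K) (+ (j ℕ.* (4 ℕ.* B) ℕ.+ 3 ℕ.* B)) (+ suc (q ℕ.+ q)) (+ m))) ⟩
        run w n ++ run (w + + 2 * + (n ℕ.+ m)) m ∎

  -- Magic rectangles

  -- The representatives are 2 to 5 because no or one single is treated apart.
  data Residue : ℕ → Set where
    4j+2 : ∀ j → Residue (j ℕ.* 4 ℕ.+ 2)
    4j+3 : ∀ j → Residue (j ℕ.* 4 ℕ.+ 3)
    4j+4 : ∀ j → Residue (suc j ℕ.* 4)
    4j+5 : ∀ j → Residue (j ℕ.* 4 ℕ.+ 5)

  residue : ∀ n → Residue (2 ℕ.+ n)
  residue 0 = 4j+2 0
  residue 1 = 4j+3 0
  residue 2 = 4j+4 0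
  residue 3 = 4j+5 0
  residue (suc (suc (suc (suc n)))) = step (residue n)
    where
    step : ∀ {k} → Residue k → Residue (4 ℕ.+ k)
    step (4j+2 j) = 4j+2 (suc j)
    step (4j+3 j) = 4j+3 (suc j)
    step (4j+4 j) = 4j+4 (suc j)
    step (4j+5 j) = 4j+5 (suc j)

  odd : ∀ p b → 1 ℕ.≤ b → b ℕ.< p → Odd p b
  odd p 1 _ b<p = odd-1 p b<p
  odd p 2 _ b<p = odd-2 p b<p
  odd p@(suc (suc (suc r))) (suc (suc (suc n))) _ (s≤s (s≤s n+2≤r+1)) = byResidue (residue n) n+2≤r+1
    where
    open OddLarge r hiding (p)
    byResidue : ∀ {K} → Residue K → K ℕ.≤ suc r → Odd p (suc K)
    byResidue (4j+2 j) = odd-4j+3 j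
    byResidue (4j+3 j) = odd-4j+4 j
    byResidue (4j+4 j) = odd-4j+5 j
    byResidue (4j+5 j) = odd-4j+6 j

  -- Pairs of opposite columns of even height

  evenColumn : ∀ h a → Pairs (h ℕ.+ h ℕ.+ (h ℕ.+ h)) 1 (run a (h ℕ.+ h ℕ.+ (h ℕ.+ h)))
  evenColumn h a = one (run-length a _) (signed-≡ (ring (+ sq h) (cong +_ (eq h)))
    -- For n = 2h the number n²/2 = 2h² is an integer, and as the parameter it makes 2n² - 4e
    -- vanish.
    (balanced (h ℕ.+ h) a (sq h ℕ.+ sq h) (subst (sq h ℕ.+ sq h ℕ.≤_) (sym (eq h)) (ℕₚ.m≤m+n _ (sq h ℕ.+ sq h)))))
    where
    eq : ∀ h → (h ℕ.+ h) ℕ.* (h ℕ.+ h) ≡ h ℕ.* h ℕ.+ h ℕ.* h ℕ.+ (h ℕ.* h ℕ.+ h ℕ.* h)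
    eq = ℕSolver.solve-∀
    ring′ : ∀ s → + 2 * (s + s + (s + s)) - + 4 * (s + s) ≡ + 0
    ring′ = solve-∀
    ring : ∀ s {S} → S ≡ s + s + (s + s) → + 2 * S - + 4 * (s + s) ≡ + 0
    ring s refl = ring′ s

  evenBound : ∀ g → suc (sq (suc g) ℕ.+ sq (suc g)) ℕ.≤ sq (suc g ℕ.+ suc g)
  evenBound g = subst (suc (sq (suc g) ℕ.+ sq (suc g)) ℕ.≤_) (sym (eq g)) (ℕₚ.m≤m+n _ _)
    where
    eq : ∀ g → (suc g ℕ.+ suc g) ℕ.* (suc g ℕ.+ suc g) ≡
         suc (suc g ℕ.* suc g ℕ.+ suc g ℕ.* suc g) ℕ.+ (g ℕ.+ g ℕ.* suc g ℕ.+ suc g ℕ.* suc g)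
    eq = ℕSolver.solve-∀

  -- The counterweight to the two values set apart in a block of height 2 modulo 4: they contribute
  -- 4, either by their difference or as 1 + 3. As q is even, a run of 2q values can reach -4.
  compensating : ∀ g a → let q = suc g ℕ.+ suc g in Signed (run a (q ℕ.+ q)) (- (+ 4))
  compensating g a = signed-≡ (ring (+ sq (suc g)) (cong +_ (eq (suc g)))) (balanced (suc g ℕ.+ suc g) a _ (evenBound g))
    where
    eq : ∀ h → (h ℕ.+ h) ℕ.* (h ℕ.+ h) ≡ h ℕ.* h ℕ.+ h ℕ.* h ℕ.+ (h ℕ.* h ℕ.+ h ℕ.* h)
    eq = ℕSolver.solve-∀
    ring′ : ∀ s → + 2 * (s + s + (s + s)) - + 4 * (+ 1 + (s + s)) ≡ - (+ 4)
    ring′ = solve-∀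
    ring : ∀ s {S} → S ≡ s + s + (s + s) → + 2 * S - + 4 * (+ 1 + (s + s)) ≡ - (+ 4)
    ring s refl = ring′ s

  module EvenOdd (g : ℕ) where

    q p B : ℕ
    q = suc g ℕ.+ suc g
    p = suc q
    B = p ℕ.+ p

    column : ∀ x y a → y - x ≡ + 4 → Pairs B 1 ((x ∷ y ∷ []) ++ run a (q ℕ.+ q))
    column x y a e = one (trans (cong (2 ℕ.+_) (run-length a (q ℕ.+ q))) (cong suc (sym (ℕₚ.+-suc q q))))
      (signed-≡ (cong (λ z → z + - (+ 4)) e) (signed-++ (signed-pair x y) (compensating g a)))

    two : ∀ a → Pairs B 2 (run a (B ℕ.+ B))
    two a = permₚ (↭-sym (exchange q a)) (column b _ a (ring b) ⊎ₚ column (b + + 2) _ _ (ring (b + + 2)))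
      where
      b : ℤ
      b = a + + 2 * + (q ℕ.+ q)
      ring : ∀ b → b + + 4 - b ≡ + 4
      ring = solve-∀

    -- Exchanged blocks come in pairs, so in the remaining one the values 1 and 3 carry the same sign instead.
    first : Pairs B 1 (run (+ 1) B)
    first = subst (λ n → Pairs B 1 (run (+ 1) n)) (sym (cong suc (ℕₚ.+-suc q q)))
      (one (trans (cong (2 ℕ.+_) (run-length (+ 5) (q ℕ.+ q))) (cong suc (sym (ℕₚ.+-suc q q))))
           (signed-++ (signed-list (+ 1 ∷ + 3 ∷ [])) (compensating g (+ 5))))

  repeat : ∀ {m k n} → (∀ a → Pairs m k (run a n)) → ∀ j a → Pairs m (j ℕ.* k) (run a (j ℕ.* n))
  repeat P zero    a = none
  repeat {n = n} P (suc j) a = permₚ (↭-reflexive (run-merge n (j ℕ.* n) refl)) (P a ⊎ₚ repeat P j (a + + 2 * + n))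

  evenPairs-even : ∀ h K → let p = h ℕ.+ h in Pairs (p ℕ.+ p) K (run (+ 1) (K ℕ.* (p ℕ.+ p)))
  evenPairs-even h K = pairs-≡ (ℕₚ.*-identityʳ K) (repeat (evenColumn h) K (+ 1))

  evenPairs-odd : ∀ g K → let p = suc (suc g ℕ.+ suc g) in Pairs (p ℕ.+ p) K (run (+ 1) (K ℕ.* (p ℕ.+ p)))
  evenPairs-odd g K = [ even , odd′ ]′ (proj₂ (halve K))
    where
    open EvenOdd g
    h : ℕ
    h = proj₁ (halve K)
    eq₁ : ∀ j → j ℕ.* 2 ≡ j ℕ.+ j
    eq₁ = ℕSolver.solve-∀
    eq₂ : ∀ j B → j ℕ.* (B ℕ.+ B) ≡ (j ℕ.+ j) ℕ.* B
    eq₂ = ℕSolver.solve-∀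
    even : K ≡ h ℕ.+ h → Pairs B K (run (+ 1) (K ℕ.* B))
    even e = subst (λ k → Pairs B k (run (+ 1) (k ℕ.* B))) (sym e)
      (subst (λ n → Pairs B (h ℕ.+ h) (run (+ 1) n)) (eq₂ h B) (pairs-≡ (eq₁ h) (repeat two h (+ 1))))
    odd′ : K ≡ suc (h ℕ.+ h) → Pairs B K (run (+ 1) (K ℕ.* B))
    odd′ e = subst (λ k → Pairs B k (run (+ 1) (k ℕ.* B))) (sym e)
      (subst (λ n → Pairs B (suc (h ℕ.+ h)) (run (+ 1) n)) (cong (B ℕ.+_) (eq₂ h B)) (pairs-≡ (cong suc (eq₁ h))
        (permₚ (↭-reflexive (run-merge B _ refl)) (first ⊎ₚ repeat two h (+ 1 + + 2 * + B)))))

  evenPairs : ∀ p K → 2 ℕ.≤ p → Pairs (p ℕ.+ p) K (run (+ 1) (K ℕ.* (p ℕ.+ p)))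
  evenPairs p K 2≤p with halve p
  evenPairs p K 2≤p      | h , inj₁ refl     = evenPairs-even h K
  evenPairs p K (s≤s ()) | zero , inj₂ refl
  evenPairs p K 2≤p      | suc g , inj₂ refl = evenPairs-odd g K

  Rect : ℕ → ℕ → Set
  Rect m s = ZeroSum m s (run (+ 1 - + (m ℕ.* s)) (m ℕ.* s))

  evenRect : ∀ p K → 2 ℕ.≤ p → Rect (p ℕ.+ p) (K ℕ.+ K)
  evenRect p K 2≤p = subst (Rect (p ℕ.+ p)) (eq₁ K) (zeroSum-↭ perm′ (fill (evenPairs p K 2≤p) zeroSum-[]))
    where
    h N : ℕ
    h = K ℕ.* (p ℕ.+ p)
    N = (p ℕ.+ p) ℕ.* (K ℕ.* 2 ℕ.+ 0)
    eq₁ : ∀ K → K ℕ.* 2 ℕ.+ 0 ≡ K ℕ.+ K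
    eq₁ = ℕSolver.solve-∀
    eq₂ : ∀ K p → (p ℕ.+ p) ℕ.* (K ℕ.* 2 ℕ.+ 0) ≡ K ℕ.* (p ℕ.+ p) ℕ.+ K ℕ.* (p ℕ.+ p)
    eq₂ = ℕSolver.solve-∀
    ring₁ : ∀ h → + 2 - + 1 - + 2 * h + + 2 * h ≡ + 1
    ring₁ = solve-∀
    ring₂ : ∀ h → + 2 - + 1 - + 2 * h ≡ + 1 - (h + h)
    ring₂ = solve-∀
    open PermutationReasoning
    perm′ : ± (run (+ 1) h) ++ [] ↭ run (+ 1 - + N) N
    perm′ = begin
      ± (run (+ 1) h) ++ []                              ≡⟨ ++-identityʳ _ ⟩
      run (+ 1) h ++ map -_ (run (+ 1) h)                ↭⟨ ++-comm (run (+ 1) h) _ ⟩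
      map -_ (run (+ 1) h) ++ run (+ 1) h                ↭⟨ ++⁺ʳ (run (+ 1) h) (neg-run (+ 1) h) ⟩
      run (+ 2 - + 1 - + 2 * + h) h ++ run (+ 1) h       ≡⟨ run-merge h h (ring₁ (+ h)) ⟩
      run (+ 2 - + 1 - + 2 * + h) (h ℕ.+ h)              ≡⟨ cong₂ run (trans (ring₂ (+ h)) (cong (λ n → + 1 - + n) (sym (eq₂ K p)))) (sym (eq₂ K p)) ⟩
      run (+ 1 - + N) N                                  ∎

  oddRect : ∀ p b → 1 ℕ.≤ b → b ℕ.< p → Rect (height p) (suc (b ℕ.+ b))
  oddRect p b 1≤b b<p = zeroSum-↭ perm′ (odd p b 1≤b b<p)
    where
    c N : ℕ
    c = p ℕ.+ height p ℕ.* b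
    N = height p ℕ.* suc (b ℕ.+ b)
    eq : ∀ p b → suc (p ℕ.+ p) ℕ.* suc (b ℕ.+ b) ≡ p ℕ.+ suc (p ℕ.+ p) ℕ.* b ℕ.+ suc (p ℕ.+ suc (p ℕ.+ p) ℕ.* b)
    eq = ℕSolver.solve-∀
    ring₁ : ∀ c → + 2 - + 2 - + 2 * c + + 2 * c ≡ + 0
    ring₁ = solve-∀
    ring₂ : ∀ c → + 2 - + 2 - + 2 * c ≡ + 1 - (c + (+ 1 + c))
    ring₂ = solve-∀
    open PermutationReasoning
    perm′ : [ + 0 ] ++ ± (run (+ 2) c) ↭ run (+ 1 - + N) N
    perm′ = begin
      run (+ 0) (suc c) ++ map -_ (run (+ 2) c)             ↭⟨ ++-comm (run (+ 0) (suc c)) _ ⟩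
      map -_ (run (+ 2) c) ++ run (+ 0) (suc c)             ↭⟨ ++⁺ʳ (run (+ 0) (suc c)) (neg-run (+ 2) c) ⟩
      run (+ 2 - + 2 - + 2 * + c) c ++ run (+ 0) (suc c)    ≡⟨ run-merge c (suc c) (ring₁ (+ c)) ⟩
      run (+ 2 - + 2 - + 2 * + c) (c ℕ.+ suc c)             ≡⟨ cong₂ run (trans (ring₂ (+ c)) (cong (λ n → + 1 - + n) (sym (eq p b)))) (sym (eq p b)) ⟩
      run (+ 1 - + N) N                                     ∎

  -- Both sides have the same parity, as they differ by 2t. From t ≥ 1 follow p ≥ 2 in the even case
  -- and b < p in the odd one.
  rect : ∀ s t → 2 ℕ.≤ s → 1 ℕ.≤ t → Rect (s ℕ.+ (t ℕ.+ t)) s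
  rect s t 2≤s 1≤t with halve s
  rect s t () 1≤t | zero , inj₁ refl
  rect s t 2≤s 1≤t | suc k , inj₁ refl = subst (λ m → Rect m s) (eq (suc k) t)
    (evenRect (suc k ℕ.+ t) (suc k) (ℕₚ.+-mono-≤ {1} (s≤s z≤n) 1≤t))
    where
    eq : ∀ k t → k ℕ.+ t ℕ.+ (k ℕ.+ t) ≡ k ℕ.+ k ℕ.+ (t ℕ.+ t)
    eq = ℕSolver.solve-∀
  rect s t (s≤s ()) 1≤t | zero , inj₂ refl
  rect s t 2≤s 1≤t | suc b , inj₂ refl = subst (λ m → Rect m s) (eq (suc b) t)
    (oddRect (suc b ℕ.+ t) (suc b) (s≤s z≤n) (ℕₚ.m<m+n (suc b) 1≤t))
    where
    eq : ∀ b t → suc (b ℕ.+ t ℕ.+ (b ℕ.+ t)) ≡ suc (b ℕ.+ b) ℕ.+ (t ℕ.+ t)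
    eq = ℕSolver.solve-∀

  -- From centred values back to the labels 1, ..., N

  record MagicRectangle (m s : ℕ) : Set where
    field
      label   : Fin m → Fin s → ℕ
      row-sum : ∀ i → 2 ℕ.* sum (tabulate (label i)) ≡ s ℕ.* suc (m ℕ.* s)
      col-sum : ∀ j → 2 ℕ.* sum (tabulate λ i → label i j) ≡ m ℕ.* suc (m ℕ.* s)
      perm    : concat (tabulate λ i → tabulate (label i)) ↭ oneTo (m ℕ.* s)

  transpose-↭ : ∀ {A : Set} {m s} (f : Fin m → Fin s → A) →
    concat (tabulate λ i → tabulate (f i)) ↭ concat (tabulate λ j → tabulate λ i → f i j)
  transpose-↭ {m = zero} {s} f = ↭-reflexive (sym (empty s))
    where
    empty : ∀ s → concat (tabulate {n = s} λ j → []) ≡ []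
    empty zero    = refl
    empty (suc s) = empty s
  transpose-↭ {A} {suc m} {s} f = ↭-trans (++⁺ˡ (tabulate (f zero)) (transpose-↭ (λ i → f (suc i)))) (merge s (f zero) _)
    where
    merge : ∀ s (g : Fin s → A) (h : Fin s → List A) → tabulate g ++ concat (tabulate h) ↭ concat (tabulate λ j → g j ∷ h j)
    merge zero    g h = ↭-refl
    merge (suc s) g h = ↭-prep (g zero) (begin
      tabulate (λ j → g (suc j)) ++ h zero ++ concat (tabulate λ j → h (suc j))
        ↭⟨ shifts (tabulate λ j → g (suc j)) (h zero) ⟩
      h zero ++ tabulate (λ j → g (suc j)) ++ concat (tabulate λ j → h (suc j))
        ↭⟨ ++⁺ˡ (h zero) (merge s (λ j → g (suc j)) (λ j → h (suc j))) ⟩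
      h zero ++ concat (tabulate λ j → g (suc j) ∷ h (suc j)) ∎)
      where open PermutationReasoning

  -- An entry v of the zero-sum array stands for the label l with v = 2 l - (N + 1).
  module Labels (N : ℕ) where

    IsValue : ℤ → Set
    IsValue v = ∃ λ l → v + + suc N ≡ + (l ℕ.+ l)

    toLabel : ℤ → ℕ
    toLabel v = ℕ.⌊ ∣ v + + suc N ∣ /2⌋

    toLabel-≡ : ∀ v l → v + + suc N ≡ + (l ℕ.+ l) → toLabel v ≡ l
    toLabel-≡ v l e = trans (cong (λ z → ℕ.⌊ ∣ z ∣ /2⌋) e) (sym (ℕₚ.n≡⌊n+n/2⌋ l))

    next : ∀ v l → v + + suc N ≡ + (l ℕ.+ l) → v + + 2 + + suc N ≡ + (suc l ℕ.+ suc l)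
    next v l e = trans (ring v (+ suc N)) (trans (cong (λ z → + 2 + z) e) (cong (λ n → + suc n) (sym (ℕₚ.+-suc l l))))
      where
      ring : ∀ v n → v + + 2 + n ≡ + 2 + (v + n)
      ring = solve-∀

    values : ∀ a l n → a + + suc N ≡ + (l ℕ.+ l) → All IsValue (run a n)
    values a l zero    e = []
    values a l (suc n) e = (l , e) ∷ values (a + + 2) (suc l) n (next a l e)

    labels : ∀ a l n (f : ℕ → ℕ) → (∀ k → f k ≡ l ℕ.+ k) → a + + suc N ≡ + (l ℕ.+ l) → map toLabel (run a n) ≡ applyUpTo f n
    labels a l zero    f h e = refl
    labels a l (suc n) f h e = cong₂ _∷_ (trans (toLabel-≡ a l e) (sym (trans (h 0) (ℕₚ.+-identityʳ l))))
      (labels (a + + 2) (suc l) n (λ k → f (suc k)) (λ k → trans (h (suc k)) (ℕₚ.+-suc l k)) (next a l e))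

    sum-labels : ∀ n (e : Fin n → ℤ) → (∀ i → IsValue (e i)) →
      + (2 ℕ.* sum (tabulate λ i → toLabel (e i))) ≡ Σℤ (tabulate e) + + (n ℕ.* suc N)
    sum-labels zero    e h = refl
    sum-labels (suc n) e h = combine (toLabel (e zero)) (e zero) (doubled (e zero) (h zero)) (sum-labels n (λ i → e (suc i)) (λ i → h (suc i)))
      where
      doubled : ∀ v → IsValue v → + (toLabel v ℕ.+ toLabel v) ≡ v + + suc N
      doubled v (l , e) = trans (cong (λ n → + (n ℕ.+ n)) (toLabel-≡ v l e)) (sym e)
      ring : ∀ v m S n → v + m + (S + n) ≡ v + S + (m + n)
      ring = solve-∀
      eq : ∀ l S → 2 ℕ.* (l ℕ.+ S) ≡ l ℕ.+ l ℕ.+ 2 ℕ.* S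
      eq = ℕSolver.solve-∀
      combine : ∀ l v {L S n} → + (l ℕ.+ l) ≡ v + + suc N → + (2 ℕ.* L) ≡ S + + n → + (2 ℕ.* (l ℕ.+ L)) ≡ v + S + + (suc N ℕ.+ n)
      combine l v {L} {S} {n} e₁ e₂ = trans (cong +_ (eq l L)) (trans (cong₂ _+_ e₁ e₂) (ring v (+ suc N) S (+ n)))

  magic : ∀ {m s} → Rect m s → MagicRectangle m s
  magic {m} {s} A = record
    { label   = λ i j → toLabel (entry A i j)
    ; row-sum = λ i → +-injective (trans (sum-labels s (entry A i) (value i)) (zero-sum (row-sum A i)))
    ; col-sum = λ j → +-injective (trans (sum-labels m (λ i → entry A i j) (λ i → value i j)) (zero-sum (col-sum A j)))
    ; perm    = perm′ }
    where
    N : ℕ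
    N = m ℕ.* s
    open Labels N
    ring : ∀ N → + 1 - N + (+ 1 + N) ≡ + 2
    ring = solve-∀
    zero-sum : ∀ {S n} → S ≡ + 0 → S + + n ≡ + n
    zero-sum refl = +-identityˡ _
    value : ∀ i j → IsValue (entry A i j)
    value i j = tabulate⁻ (tabulate⁻ (concat⁻ (All-resp-↭ (↭-sym (perm A)) (values _ 1 N (ring (+ N))))) j) i
    open PermutationReasoning
    perm′ : concat (tabulate λ i → tabulate λ j → toLabel (entry A i j)) ↭ oneTo N
    perm′ = begin
      concat (tabulate λ i → tabulate λ j → toLabel (entry A i j))
        ↭⟨ transpose-↭ (λ i j → toLabel (entry A i j)) ⟩
      concat (tabulate λ j → tabulate λ i → toLabel (entry A i j))
        ≡⟨ cong concat (trans (tabulate-cong λ j → sym (map-tabulate (λ i → entry A i j) toLabel)) (sym (map-tabulate _ (map toLabel)))) ⟩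
      concat (map (map toLabel) (tabulate λ j → tabulate λ i → entry A i j))
        ≡⟨ concat-map (tabulate λ j → tabulate λ i → entry A i j) ⟩
      map toLabel (concat (tabulate λ j → tabulate λ i → entry A i j))
        ↭⟨ map⁺ toLabel (perm A) ⟩
      map toLabel (run (+ 1 - + N) N)
        ≡⟨ labels _ 1 N suc (λ _ → refl) (ring (+ N)) ⟩
      applyUpTo suc N
        ≡⟨ map-applyUpTo (λ k → k) suc N ⟨
      oneTo N ∎

  magicRectangle : ∀ s t → 2 ℕ.≤ s → 1 ℕ.≤ t → MagicRectangle (s ℕ.+ (t ℕ.+ t)) s
  magicRectangle s t 2≤s 1≤t = magic (rect s t 2≤s 1≤t)

open import Defs hiding (sym)
open MagicRectangles using (MagicRectangle; magicRectangle)
open import Data.Bool using (Bool; true; false; if_then_else_)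
open import Data.Bool.Properties using (T-≡)
open import Data.Nat using (ℕ; zero; suc; _+_; _*_; _∸_; _≤_; _<_; _<ᵇ_; z≤n; s≤s; ⌊_/2⌋; _≟_; >-nonZero)
open import Data.Nat.Properties
open import Data.Nat.Divisibility using (_∣_; divides)
open import Data.Nat.ListAction using (sum)
open import Data.Nat.ListAction.Properties using (sum-++)
import Data.Nat.Tactic.RingSolver as ℕSolver
open import Data.Fin using (Fin; zero; suc; toℕ; splitAt; _↑ˡ_; _↑ʳ_; punchOut; join)
open import Data.Fin.Properties using (splitAt-↑ˡ; splitAt-↑ʳ; join-splitAt; toℕ-↑ˡ; toℕ-↑ʳ; toℕ<n; punchOut-injective) renaming (suc-injective to suc-injective′)
open import Data.List using (List; []; _∷_; _++_; map; length; filterᵇ; concat; concatMap; tabulate; allFin; deduplicate; applyUpTo; upTo)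
open import Data.List.Properties using (map-++; map-∘; map-cong; ++-identityʳ; ++-assoc; length-++; length-map; map-tabulate; tabulate-cong; filter-++; filter-all; filter-none; concatMap-++; concatMap-cong; concatMap-map; map-concatMap; map-applyUpTo; length-tabulate; length-upTo)
open import Data.List.Membership.Propositional using (_∈_)
open import Data.List.Membership.Propositional.Properties using (∈-map⁺; ∈-map⁻; ∈-allFin; ∈-deduplicate⁺; ∈-deduplicate⁻)
open import Data.List.Membership.Propositional.Properties.WithK using (unique∧set⇒bag)
open import Data.List.Relation.Binary.BagAndSetEquality using (∼bag⇒↭)
open import Data.List.Relation.Binary.Permutation.Propositional using (_↭_; ↭-refl; ↭-reflexive; ↭-trans; module PermutationReasoning)
open import Data.List.Relation.Binary.Permutation.Propositional.Properties using (↭-length; ++⁺ˡ; ++-comm; shifts) renaming (map⁺ to ↭-map⁺)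
open import Data.List.Relation.Unary.All as All using (All; []; _∷_)
open import Data.List.Relation.Unary.Any using (here; there; index)
open import Data.List.Relation.Unary.Any.Properties using (lookup-index)
open import Data.List.Relation.Unary.Unique.Propositional using (Unique; []; _∷_)
import Data.List.Relation.Unary.Unique.Propositional.Properties as Unique
open import Data.List.Relation.Unary.Unique.DecPropositional.Properties _≟_ using (deduplicate-!)
open import Data.Product using (_×_; _,_; proj₂)
open import Data.Sum using (_⊎_; inj₁; inj₂)
open import Data.List using (lookup)
open import Function using (_∘_; id)
open import Function.Bundles using (mk⇔; Equivalence)
open import Relation.Binary.PropositionalEquality using (_≡_; _≢_; refl; ≢-sym; sym; trans; cong; cong₂; subst; module ≡-Reasoning)
open import Relation.Nullary using (contradiction)

-- The join with an edgeless graph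

module _ {A : Set} where

  filterᵇ-cong : ∀ {p q : A → Bool} → (∀ x → p x ≡ q x) → ∀ xs → filterᵇ p xs ≡ filterᵇ q xs
  filterᵇ-cong h [] = refl
  filterᵇ-cong {p} {q} h (x ∷ xs) with p x | q x | h x
  ... | true  | .true  | refl = cong (x ∷_) (filterᵇ-cong h xs)
  ... | false | .false | refl = filterᵇ-cong h xs

  filterᵇ-true : ∀ {p : A → Bool} → (∀ x → p x ≡ true) → ∀ xs → filterᵇ p xs ≡ xs
  filterᵇ-true h xs = trans (filterᵇ-cong h xs) (filter-all _ (All.universal (λ _ → _) xs))

  filterᵇ-false : ∀ {p : A → Bool} → (∀ x → p x ≡ false) → ∀ xs → filterᵇ p xs ≡ []
  filterᵇ-false h xs = trans (filterᵇ-cong h xs) (filter-none _ (All.universal (λ _ ()) xs))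

  filterᵇ-map : ∀ {B : Set} (p : B → Bool) (f : A → B) xs → filterᵇ p (map f xs) ≡ map f (filterᵇ (p ∘ f) xs)
  filterᵇ-map p f [] = refl
  filterᵇ-map p f (x ∷ xs) with p (f x)
  ... | true  = cong (f x ∷_) (filterᵇ-map p f xs)
  ... | false = filterᵇ-map p f xs

  concatMap-[] : ∀ {B : Set} (xs : List A) → concatMap {B = B} (λ _ → []) xs ≡ []
  concatMap-[] []       = refl
  concatMap-[] (x ∷ xs) = concatMap-[] xs

  concatMap-++-↭ : ∀ {B : Set} (f g : A → List B) xs → concatMap (λ x → f x ++ g x) xs ↭ concatMap f xs ++ concatMap g xs
  concatMap-++-↭ f g []       = ↭-refl
  concatMap-++-↭ f g (x ∷ xs) = begin
    (f x ++ g x) ++ concatMap (λ x → f x ++ g x) xs       ↭⟨ ++⁺ˡ (f x ++ g x) (concatMap-++-↭ f g xs) ⟩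
    (f x ++ g x) ++ concatMap f xs ++ concatMap g xs      ≡⟨ ++-assoc (f x) (g x) _ ⟩
    f x ++ g x ++ concatMap f xs ++ concatMap g xs        ↭⟨ ++⁺ˡ (f x) (shifts (g x) (concatMap f xs)) ⟩
    f x ++ concatMap f xs ++ g x ++ concatMap g xs        ≡⟨ ++-assoc (f x) (concatMap f xs) _ ⟨
    (f x ++ concatMap f xs) ++ g x ++ concatMap g xs      ∎
    where open PermutationReasoning

tabulate-++ : ∀ {A : Set} m {s} (f : Fin (m + s) → A) →
  tabulate f ≡ tabulate (λ i → f (i ↑ˡ s)) ++ tabulate (λ j → f (m ↑ʳ j))
tabulate-++ zero    f = refl
tabulate-++ (suc m) f = cong (f zero ∷_) (tabulate-++ m (f ∘ suc))

length-distinct : ∀ {xs ys} → Unique ys → (∀ {x} → x ∈ xs → x ∈ ys) → (∀ {x} → x ∈ ys → x ∈ xs) →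
  length (deduplicate _≟_ xs) ≡ length ys
length-distinct {xs} ys! ⊆ ⊇ = ↭-length (∼bag⇒↭ (unique∧set⇒bag (deduplicate-! xs) ys!
  (mk⇔ (⊆ ∘ ∈-deduplicate⁻ _≟_ xs) (∈-deduplicate⁺ _≟_ ∘ ⊇))))

sum-shift : ∀ {A : Set} (f : A → ℕ) c xs → sum (map (λ x → f x + c) xs) ≡ sum (map f xs) + length xs * c
sum-shift f c []       = refl
sum-shift f c (x ∷ xs) = trans (cong (f x + c +_) (sum-shift f c xs)) (eq (f x) c (sum (map f xs)) (length xs * c))
  where
  eq : ∀ a c s l → a + c + (s + l) ≡ a + s + (c + l)
  eq = ℕSolver.solve-∀

oneTo-+ : ∀ m n → oneTo (m + n) ≡ oneTo m ++ map (_+ m) (oneTo n)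
oneTo-+ m n = begin
  map suc (upTo (m + n))                               ≡⟨ map-applyUpTo id suc (m + n) ⟩
  applyUpTo suc (m + n)                                ≡⟨ split m n suc ⟩
  applyUpTo suc m ++ applyUpTo (λ k → suc (m + k)) n   ≡⟨ cong (applyUpTo suc m ++_) (cong-upTo (λ k → cong suc (+-comm m k)) n) ⟩
  applyUpTo suc m ++ applyUpTo (λ k → suc k + m) n     ≡⟨ cong₂ _++_ (map-applyUpTo id suc m) (trans (cong (map (_+ m)) (map-applyUpTo id suc n)) (map-applyUpTo suc (_+ m) n)) ⟨
  oneTo m ++ map (_+ m) (oneTo n)                      ∎
  where
  open ≡-Reasoning
  split : ∀ m n (f : ℕ → ℕ) → applyUpTo f (m + n) ≡ applyUpTo f m ++ applyUpTo (λ k → f (m + k)) n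
  split zero    n f = refl
  split (suc m) n f = cong (f 0 ∷_) (split m n (f ∘ suc))
  cong-upTo : ∀ {f g : ℕ → ℕ} → (∀ k → f k ≡ g k) → ∀ n → applyUpTo f n ≡ applyUpTo g n
  cong-upTo h zero    = refl
  cong-upTo h (suc n) = cong₂ _∷_ (h 0) (cong-upTo (h ∘ suc) n)

<ᵇ-true : ∀ {a b} → a < b → (a <ᵇ b) ≡ true
<ᵇ-true a<b = Equivalence.to T-≡ (<⇒<ᵇ a<b)

<ᵇ-false : ∀ {a b} → b ≤ a → (a <ᵇ b) ≡ false
<ᵇ-false {a} {b} b≤a with a <ᵇ b in eq
... | false = refl
... | true  = contradiction (<ᵇ⇒< a b (Equivalence.from T-≡ eq)) (≤⇒≯ b≤a)

-- The far ends of the edges that `edges` lists at i. In the join the new vertices come last, so all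
-- added edges are listed at old vertices, row by row of the rectangle.
later : (G : Graph) → Fin (n G) → List (Fin (n G))
later G i = filterᵇ (λ j → if toℕ i <ᵇ toℕ j then adj G i j else false) (verts G)

edgeLabels-later : ∀ G ℓ → edgeLabels G ℓ ≡ concatMap (λ i → map (ℓ i) (later G i)) (verts G)
edgeLabels-later G ℓ = trans (map-concatMap _ _ (verts G)) (concatMap-cong (λ i → sym (map-∘ (later G i))) (verts G))

size-edgeLabels : ∀ G ℓ → size G ≡ length (edgeLabels G ℓ)
size-edgeLabels G ℓ = sym (length-map _ (edges G))

module Join (G : Graph) (s : ℕ) where

  m : ℕ
  m = n G

  J : Graph
  J = G ∨G O s

  old : Fin m → Fin (m + s)
  old = _↑ˡ s

  new : Fin s → Fin (m + s)
  new = m ↑ʳ_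

  verts-J : verts J ≡ map old (verts G) ++ map new (allFin s)
  verts-J = trans (tabulate-++ m id) (cong₂ _++_ (sym (map-tabulate id old)) (sym (map-tabulate id new)))

  by-cases : {P : Fin (m + s) → Set} → (∀ i → P (old i)) → (∀ j → P (new j)) → ∀ x → P x
  by-cases {P} f g x = subst P (join-splitAt m s x) ([_]-case (splitAt m x))
    where
    [_]-case : ∀ v → P (join m s v)
    [ inj₁ i ]-case = f i
    [ inj₂ j ]-case = g j

  adj-old-old : ∀ i j → adj J (old i) (old j) ≡ adj G i j
  adj-old-old i j rewrite splitAt-↑ˡ m i s | splitAt-↑ˡ m j s = refl

  adj-old-new : ∀ i j → adj J (old i) (new j) ≡ true
  adj-old-new i j rewrite splitAt-↑ˡ m i s | splitAt-↑ʳ m s j = refl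

  adj-new-old : ∀ j i → adj J (new j) (old i) ≡ true
  adj-new-old j i rewrite splitAt-↑ˡ m i s | splitAt-↑ʳ m s j = refl

  adj-new-new : ∀ i j → adj J (new i) (new j) ≡ false
  adj-new-new i j rewrite splitAt-↑ʳ m s i | splitAt-↑ʳ m s j = refl

  filter-J : ∀ p → filterᵇ p (verts J) ≡ map old (filterᵇ (p ∘ old) (verts G)) ++ map new (filterᵇ (p ∘ new) (allFin s))
  filter-J p = trans (cong (filterᵇ p) verts-J) (trans (filter-++ _ (map old (verts G)) _)
    (cong₂ _++_ (filterᵇ-map p old (verts G)) (filterᵇ-map p new (allFin s))))

  neighbours-old : ∀ i → filterᵇ (adj J (old i)) (verts J) ≡ map old (filterᵇ (adj G i) (verts G)) ++ map new (allFin s)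
  neighbours-old i = trans (filter-J (adj J (old i))) (cong₂ (λ xs ys → map old xs ++ map new ys)
    (filterᵇ-cong (adj-old-old i) (verts G)) (filterᵇ-true (adj-old-new i) (allFin s)))

  neighbours-new : ∀ j → filterᵇ (adj J (new j)) (verts J) ≡ map old (verts G)
  neighbours-new j = trans (filter-J (adj J (new j))) (trans (cong₂ (λ xs ys → map old xs ++ map new ys)
    (filterᵇ-true (adj-new-old j) (verts G)) (filterᵇ-false (adj-new-new j) (allFin s))) (++-identityʳ _))

  deg-old : ∀ i → deg J (old i) ≡ deg G i + s
  deg-old i = trans (cong length (neighbours-old i)) (trans (length-++ (map old nbs))
    (cong₂ _+_ (length-map old nbs) (trans (length-map new (allFin s)) (length-tabulate {n = s} id))))
    where
    nbs : List (Fin m)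
    nbs = filterᵇ (adj G i) (verts G)

  deg-new : ∀ j → deg J (new j) ≡ m
  deg-new j = trans (cong length (neighbours-new j)) (trans (length-map old (verts G)) (length-tabulate {n = m} id))

  later-old : ∀ i → later J (old i) ≡ map old (later G i) ++ map new (allFin s)
  later-old i = trans (filter-J _) (cong₂ (λ xs ys → map old xs ++ map new ys)
    (filterᵇ-cong old-old (verts G)) (filterᵇ-true old-new (allFin s)))
    where
    old-old : ∀ j → (if toℕ (old i) <ᵇ toℕ (old j) then adj J (old i) (old j) else false)
                    ≡ (if toℕ i <ᵇ toℕ j then adj G i j else false)
    old-old j rewrite toℕ-↑ˡ i s | toℕ-↑ˡ j s | adj-old-old i j = refl
    old<new : ∀ j → toℕ (old i) < toℕ (new j)
    old<new j rewrite toℕ-↑ˡ i s | toℕ-↑ʳ m j = ≤-trans (toℕ<n i) (m≤m+n m (toℕ j))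
    old-new : ∀ j → (if toℕ (old i) <ᵇ toℕ (new j) then adj J (old i) (new j) else false) ≡ true
    old-new j rewrite <ᵇ-true (old<new j) = adj-old-new i j

  later-new : ∀ j → later J (new j) ≡ []
  later-new j = trans (filter-J _) (cong₂ (λ xs ys → map old xs ++ map new ys)
    (filterᵇ-false new-old (verts G)) (filterᵇ-false new-new (allFin s)))
    where
    old≤new : ∀ i → toℕ (old i) ≤ toℕ (new j)
    old≤new i rewrite toℕ-↑ˡ i s | toℕ-↑ʳ m j = ≤-trans (<⇒≤ (toℕ<n i)) (m≤m+n m (toℕ j))
    new-old : ∀ i → (if toℕ (new j) <ᵇ toℕ (old i) then adj J (new j) (old i) else false) ≡ false
    new-old i rewrite <ᵇ-false (old≤new i) = refl
    new-new : ∀ i → (if toℕ (new j) <ᵇ toℕ (new i) then adj J (new j) (new i) else false) ≡ false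
    new-new i with toℕ (new j) <ᵇ toℕ (new i)
    ... | true  = adj-new-new j i
    ... | false = refl

  regular : ∀ {d} → Regular G d → d + s ≡ m → Regular J m
  regular reg d+s≡m = by-cases
    (λ i → trans (deg-old i) (trans (cong (_+ s) (reg i)) d+s≡m)) deg-new

  colourable⁺ : ∀ {k} → Colourable G k → Colourable J (suc k)
  colourable⁺ {k} (c , proper) = c′ , λ u v → by-cases {λ u → adj J u v ≡ true → c′ u ≢ c′ v}
      (λ i → by-cases {λ v → adj J (old i) v ≡ true → c′ (old i) ≢ c′ v} (old-old i) (old-new i) v)
      (λ j → by-cases {λ v → adj J (new j) v ≡ true → c′ (new j) ≢ c′ v} (new-old j) (new-new j) v) u
    where
    colour : Fin m ⊎ Fin s → Fin (suc k)
    colour (inj₁ i) = suc (c i)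
    colour (inj₂ j) = zero
    c′ : Fin (m + s) → Fin (suc k)
    c′ x = colour (splitAt m x)
    old-old : ∀ i i′ → adj J (old i) (old i′) ≡ true → c′ (old i) ≢ c′ (old i′)
    old-old i i′ a rewrite splitAt-↑ˡ m i s | splitAt-↑ˡ m i′ s = λ e → proper i i′ a (suc-injective′ e)
    old-new : ∀ i j → adj J (old i) (new j) ≡ true → c′ (old i) ≢ c′ (new j)
    old-new i j _ rewrite splitAt-↑ˡ m i s | splitAt-↑ʳ m s j = λ ()
    new-old : ∀ j i → adj J (new j) (old i) ≡ true → c′ (new j) ≢ c′ (old i)
    new-old j i _ rewrite splitAt-↑ˡ m i s | splitAt-↑ʳ m s j = λ ()
    new-new : ∀ j j′ → adj J (new j) (new j′) ≡ true → c′ (new j) ≢ c′ (new j′)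
    new-new j j′ a = contradiction (trans (sym a) (adj-new-new j j′)) λ ()

  -- The colour of a new vertex does not occur on G.
  colourable⁻ : Fin s → ∀ {k} → Colourable J (suc k) → Colourable G k
  colourable⁻ j {k} (c , proper) = (λ i → punchOut (distinct i)) ,
    λ u v a e → proper (old u) (old v) (trans (adj-old-old u v) a) (punchOut-injective (distinct u) (distinct v) e)
    where
    distinct : ∀ i → c (new j) ≢ c (old i)
    distinct i = proper (new j) (old i) (adj-new-old j i)

  chromatic : Fin s → ∀ {k} → IsChromaticNumber G k → IsChromaticNumber J (suc k)
  chromatic j {k} (col , minimal) = colourable⁺ col , bound
    where
    bound : ∀ k′ → Colourable J k′ → suc k ≤ k′
    bound zero     (c , _) with () ← c (new j)
    bound (suc k′) C       = s≤s (minimal k′ (colourable⁻ j C))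

-- This is χ ≤ χ_la, the source of the lower bound: the colour of a vertex is the position of its
-- sum among the distinct sums.
colouring : ∀ G ℓ → IsLocalAntimagic G ℓ → Colourable G (numColours G ℓ)
colouring G ℓ (_ , _ , proper) = (λ u → index (occurs u)) ,
  λ u v a e → proper u v a (trans (lookup-index (occurs u)) (trans (cong (lookup colours) e) (sym (lookup-index (occurs v)))))
  where
  colours : List ℕ
  colours = deduplicate _≟_ (map (vsum G ℓ) (verts G))
  occurs : ∀ u → vsum G ℓ u ∈ colours
  occurs u = ∈-deduplicate⁺ _≟_ (∈-map⁺ (vsum G ℓ) (∈-allFin u))

-- The labelling of the join and its colours

≡⌊/2⌋ : ∀ a {b} → 2 * a ≡ b → a ≡ ⌊ b /2⌋
≡⌊/2⌋ a refl = trans (n≡⌊n+n/2⌋ a) (cong (λ x → ⌊ a + x /2⌋) (sym (+-identityʳ a)))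

2*⌊/2⌋ : ∀ a {b} → 2 * a ≡ b → 2 * ⌊ b /2⌋ ≡ b
2*⌊/2⌋ a e = trans (cong (2 *_) (sym (≡⌊/2⌋ a e))) e

module JoinLabelling (G : Graph) (s t r : ℕ) (m≡ : n G ≡ s + (t + t)) (2≤s : 2 ≤ s) (1≤t : 1 ≤ t) (t≤r : t ≤ r)
  (reg : Regular G (2 * r)) where

  open Join G s public

  M : MagicRectangle m s
  M = subst (λ m → MagicRectangle m s) (sym m≡) (magicRectangle s t 2≤s 1≤t)

  open MagicRectangle M using (label) renaming (row-sum to label-row; col-sum to label-col; perm to label-perm)

  -- `ρ` and `γ` are the common row and column sums of the rectangle; the halving is exact because
  -- sums are stated doubled there.
  N ρ γ : ℕ
  N = m * s
  ρ = ⌊ s * suc N /2⌋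
  γ = ⌊ m * suc N /2⌋

  someNew : Fin s
  someNew = subst Fin (m+[n∸m]≡n 2≤s) zero

  module _ (ℓ : Fin m → Fin m → ℕ) where

    on-sum : Fin m ⊎ Fin s → Fin m ⊎ Fin s → ℕ
    on-sum (inj₁ i) (inj₁ i′) = ℓ i i′ + N
    on-sum (inj₁ i) (inj₂ j)  = label i j
    on-sum (inj₂ j) (inj₁ i)  = label i j
    -- A default value: new vertices are pairwise non-adjacent.
    on-sum (inj₂ j) (inj₂ j′) = 0

    ext : Fin (m + s) → Fin (m + s) → ℕ
    ext x y = on-sum (splitAt m x) (splitAt m y)

    ext-sym : (∀ u v → ℓ u v ≡ ℓ v u) → ∀ x y → ext x y ≡ ext y x
    ext-sym ℓ-sym x y with splitAt m x | splitAt m y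
    ... | inj₁ i | inj₁ i′ = cong (_+ N) (ℓ-sym i i′)
    ... | inj₁ i | inj₂ j  = refl
    ... | inj₂ j | inj₁ i  = refl
    ... | inj₂ j | inj₂ j′ = refl

    ext-old-old : ∀ i i′ → ext (old i) (old i′) ≡ ℓ i i′ + N
    ext-old-old i i′ rewrite splitAt-↑ˡ m i s | splitAt-↑ˡ m i′ s = refl

    ext-old-new : ∀ i j → ext (old i) (new j) ≡ label i j
    ext-old-new i j rewrite splitAt-↑ˡ m i s | splitAt-↑ʳ m s j = refl

    ext-new-old : ∀ j i → ext (new j) (old i) ≡ label i j
    ext-new-old j i rewrite splitAt-↑ˡ m i s | splitAt-↑ʳ m s j = refl

    map-ext-old : ∀ i xs ys → map (ext (old i)) (map old xs ++ map new ys) ≡ map (λ i′ → ℓ i i′ + N) xs ++ map (label i) ys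
    map-ext-old i xs ys = trans (map-++ (ext (old i)) (map old xs) (map new ys)) (cong₂ _++_
      (trans (sym (map-∘ xs)) (map-cong (ext-old-old i) xs)) (trans (sym (map-∘ ys)) (map-cong (ext-old-new i) ys)))

    vsum-old : ∀ i → vsum J ext (old i) ≡ vsum G ℓ i + (2 * r * N + ρ)
    vsum-old i = begin
      sum (map (ext (old i)) (filterᵇ (adj J (old i)) (verts J)))
        ≡⟨ cong (sum ∘ map (ext (old i))) (neighbours-old i) ⟩
      sum (map (ext (old i)) (map old nbs ++ map new (allFin s)))
        ≡⟨ cong sum (map-ext-old i nbs (allFin s)) ⟩
      sum (map (λ i′ → ℓ i i′ + N) nbs ++ map (label i) (allFin s))
        ≡⟨ sum-++ (map (λ i′ → ℓ i i′ + N) nbs) _ ⟩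
      sum (map (λ i′ → ℓ i i′ + N) nbs) + sum (map (label i) (allFin s))
        ≡⟨ cong₂ _+_ (trans (sum-shift (ℓ i) N nbs) (cong (λ d → vsum G ℓ i + d * N) (reg i)))
                     (trans (cong sum (map-tabulate id (label i))) (≡⌊/2⌋ _ (label-row i))) ⟩
      vsum G ℓ i + 2 * r * N + ρ
        ≡⟨ +-assoc (vsum G ℓ i) _ _ ⟩
      vsum G ℓ i + (2 * r * N + ρ) ∎
      where
      open ≡-Reasoning
      nbs : List (Fin m)
      nbs = filterᵇ (adj G i) (verts G)

    vsum-new : ∀ j → vsum J ext (new j) ≡ γ
    vsum-new j = begin
      sum (map (ext (new j)) (filterᵇ (adj J (new j)) (verts J)))  ≡⟨ cong (sum ∘ map (ext (new j))) (neighbours-new j) ⟩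
      sum (map (ext (new j)) (map old (verts G)))                  ≡⟨ cong sum (trans (sym (map-∘ (verts G))) (map-cong (ext-new-old j) (verts G))) ⟩
      sum (map (λ i → label i j) (verts G))                        ≡⟨ cong sum (map-tabulate id (λ i → label i j)) ⟩
      sum (tabulate (λ i → label i j))                             ≡⟨ ≡⌊/2⌋ _ (label-col j) ⟩
      γ                                                            ∎
      where open ≡-Reasoning

    edgeLabels-↭ : edgeLabels J ext ↭ oneTo N ++ map (_+ N) (edgeLabels G ℓ)
    edgeLabels-↭ = begin
      edgeLabels J ext
        ≡⟨ edgeLabels-later J ext ⟩
      concatMap F (verts J)
        ≡⟨ trans (cong (concatMap F) verts-J) (concatMap-++ F (map old (verts G)) _) ⟩
      concatMap F (map old (verts G)) ++ concatMap F (map new (allFin s))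
        ≡⟨ cong₂ _++_ (trans (concatMap-map F old (verts G)) (concatMap-cong F-old (verts G)))
             (trans (concatMap-map F new (allFin s)) (trans (concatMap-cong (λ j → cong (map (ext (new j))) (later-new j)) (allFin s)) (concatMap-[] (allFin s)))) ⟩
      concatMap (λ i → map (λ i′ → ℓ i i′ + N) (later G i) ++ map (label i) (allFin s)) (verts G) ++ []
        ≡⟨ ++-identityʳ _ ⟩
      concatMap (λ i → map (λ i′ → ℓ i i′ + N) (later G i) ++ map (label i) (allFin s)) (verts G)
        ↭⟨ concatMap-++-↭ (λ i → map (λ i′ → ℓ i i′ + N) (later G i)) (λ i → map (label i) (allFin s)) (verts G) ⟩
      concatMap (λ i → map (λ i′ → ℓ i i′ + N) (later G i)) (verts G) ++ concatMap (λ i → map (label i) (allFin s)) (verts G)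
        ≡⟨ cong₂ _++_ old-part new-part ⟩
      map (_+ N) (edgeLabels G ℓ) ++ concat (tabulate λ i → tabulate (label i))
        ↭⟨ ++⁺ˡ (map (_+ N) (edgeLabels G ℓ)) label-perm ⟩
      map (_+ N) (edgeLabels G ℓ) ++ oneTo N
        ↭⟨ ++-comm (map (_+ N) (edgeLabels G ℓ)) (oneTo N) ⟩
      oneTo N ++ map (_+ N) (edgeLabels G ℓ) ∎
      where
      open PermutationReasoning
      F : Fin (m + s) → List ℕ
      F x = map (ext x) (later J x)
      F-old : ∀ i → F (old i) ≡ map (λ i′ → ℓ i i′ + N) (later G i) ++ map (label i) (allFin s)
      F-old i = trans (cong (map (ext (old i))) (later-old i)) (map-ext-old i (later G i) (allFin s))
      old-part : concatMap (λ i → map (λ i′ → ℓ i i′ + N) (later G i)) (verts G) ≡ map (_+ N) (edgeLabels G ℓ)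
      old-part = sym (trans (cong (map (_+ N)) (edgeLabels-later G ℓ)) (trans (map-concatMap (_+ N) _ (verts G))
        (concatMap-cong (λ i → sym (map-∘ (later G i))) (verts G))))
      new-part : concatMap (λ i → map (label i) (allFin s)) (verts G) ≡ concat (tabulate λ i → tabulate (label i))
      new-part = cong concat (trans (map-tabulate id _) (tabulate-cong (λ i → map-tabulate id (label i))))

    new<old : ∀ i → γ < vsum G ℓ i + (2 * r * N + ρ)
    new<old i = *-cancelˡ-< 2 γ _ (begin-strict
      2 * γ                                    ≡⟨ double-half someNew ⟩
      m * suc N                                ≡⟨ cong (_* suc N) m≡ ⟩
      (s + (t + t)) * suc N                    ≡⟨ eq₁ s t N ⟩
      -- Here t ≥ 1 and N > 1 enter; they make the inequality strict.
      (t + t) * N + (t + t) + s * suc N        <⟨ +-monoˡ-< (s * suc N) (+-monoʳ-< ((t + t) * N) 2t<2tN) ⟩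
      (t + t) * N + (t + t) * N + s * suc N    ≤⟨ +-monoˡ-≤ (s * suc N) (+-mono-≤ 2tN≤2rN 2tN≤2rN) ⟩
      (r + r) * N + (r + r) * N + s * suc N    ≡⟨ cong ((r + r) * N + (r + r) * N +_) (sym (double-half′ i)) ⟩
      (r + r) * N + (r + r) * N + 2 * ρ        ≡⟨ eq₂ r N ρ ⟩
      2 * (2 * r * N + ρ)                      ≤⟨ *-monoʳ-≤ 2 (m≤n+m _ (vsum G ℓ i)) ⟩
      2 * (vsum G ℓ i + (2 * r * N + ρ))       ∎)
      where
      open ≤-Reasoning
      double-half : Fin s → 2 * γ ≡ m * suc N
      double-half j = 2*⌊/2⌋ (sum (tabulate λ i → label i j)) (label-col j)
      double-half′ : Fin m → 2 * ρ ≡ s * suc N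
      double-half′ i = 2*⌊/2⌋ (sum (tabulate (label i))) (label-row i)
      eq₁ : ∀ s t N → (s + (t + t)) * suc N ≡ (t + t) * N + (t + t) + s * suc N
      eq₁ = ℕSolver.solve-∀
      eq₂ : ∀ r N ρ → (r + r) * N + (r + r) * N + 2 * ρ ≡ 2 * (2 * r * N + ρ)
      eq₂ = ℕSolver.solve-∀
      1<N : 1 < N
      1<N = ≤-trans 2≤s (≤-trans (≤-reflexive (sym (*-identityˡ s)))
        (*-monoˡ-≤ s (≤-trans (≤-trans (s≤s z≤n) 2≤s) (≤-trans (m≤m+n s (t + t)) (≤-reflexive (sym m≡))))))
      2t<2tN : t + t < (t + t) * N
      2t<2tN = subst (_< (t + t) * N) (*-identityʳ (t + t)) (*-monoʳ-< (t + t) {{>-nonZero (≤-trans 1≤t (m≤m+n t t))}} 1<N)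
      2tN≤2rN : (t + t) * N ≤ (r + r) * N
      2tN≤2rN = *-monoˡ-≤ N (+-mono-≤ t≤r t≤r)

    ext-antimagic : IsLocalAntimagic G ℓ → IsLocalAntimagic J ext
    ext-antimagic (ℓ-sym , bij , proper) = ext-sym ℓ-sym , bij′ , λ u v → by-cases {λ u → adj J u v ≡ true → vsum J ext u ≢ vsum J ext v}
        (λ i → by-cases {λ v → adj J (old i) v ≡ true → vsum J ext (old i) ≢ vsum J ext v} (old-old i) (old-new i) v)
        (λ j → by-cases {λ v → adj J (new j) v ≡ true → vsum J ext (new j) ≢ vsum J ext v} (λ i _ → ≢-sym (old-new i j (adj-old-new i j))) (new-new j) v) u
      where
      bij″ : edgeLabels J ext ↭ oneTo (N + size G)
      bij″ = ↭-trans edgeLabels-↭ (↭-trans (++⁺ˡ (oneTo N) (↭-map⁺ (_+ N) bij)) (↭-reflexive (sym (oneTo-+ N (size G)))))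
      bij′ : edgeLabels J ext ↭ oneTo (size J)
      bij′ = subst (λ q → edgeLabels J ext ↭ oneTo q) (sym (trans (size-edgeLabels J ext) (trans (↭-length bij″)
        (trans (length-map suc (upTo (N + size G))) (length-upTo (N + size G)))))) bij″
      old-old : ∀ i i′ → adj J (old i) (old i′) ≡ true → vsum J ext (old i) ≢ vsum J ext (old i′)
      old-old i i′ a e = proper i i′ (trans (sym (adj-old-old i i′)) a)
        (+-cancelʳ-≡ _ (vsum G ℓ i) (vsum G ℓ i′) (trans (sym (vsum-old i)) (trans e (vsum-old i′))))
      old-new : ∀ i j → adj J (old i) (new j) ≡ true → vsum J ext (old i) ≢ vsum J ext (new j)
      old-new i j _ e = <⇒≢ (new<old i) (trans (sym (vsum-new j)) (trans (sym e) (vsum-old i)))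
      new-new : ∀ j j′ → adj J (new j) (new j′) ≡ true → vsum J ext (new j) ≢ vsum J ext (new j′)
      new-new j j′ a = contradiction (trans (sym a) (adj-new-new j j′)) λ ()

    ext-numColours : numColours J ext ≡ suc (numColours G ℓ)
    ext-numColours = trans (length-distinct distinct ⊆ ⊇) (cong suc (length-map shift (deduplicate _≟_ colours)))
      where
      shift : ℕ → ℕ
      shift c = c + (2 * r * N + ρ)
      colours : List ℕ
      colours = map (vsum G ℓ) (verts G)
      all-colours : List ℕ
      all-colours = γ ∷ map shift (deduplicate _≟_ colours)
      fresh : ∀ {c} → c ∈ map shift (deduplicate _≟_ colours) → γ ≢ c
      fresh c∈ refl with ∈-map⁻ shift c∈
      ... | d , d∈ , e with ∈-map⁻ (vsum G ℓ) (∈-deduplicate⁻ _≟_ colours d∈)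
      ...   | i , _ , refl = <⇒≢ (new<old i) e
      distinct : Unique all-colours
      distinct = All.tabulate fresh ∷ Unique.map⁺ (+-cancelʳ-≡ _ _ _) (deduplicate-! colours)
      ⊆ : ∀ {c} → c ∈ map (vsum J ext) (verts J) → c ∈ all-colours
      ⊆ c∈ with ∈-map⁻ (vsum J ext) c∈
      ... | x , _ , refl = by-cases {λ x → vsum J ext x ∈ all-colours}
        (λ i → there (subst (_∈ map shift (deduplicate _≟_ colours)) (sym (vsum-old i))
          (∈-map⁺ shift (∈-deduplicate⁺ _≟_ (∈-map⁺ (vsum G ℓ) (∈-allFin i))))))
        (λ j → here (vsum-new j)) x
      ⊇ : ∀ {c} → c ∈ all-colours → c ∈ map (vsum J ext) (verts J)
      ⊇ (here refl) = subst (_∈ map (vsum J ext) (verts J)) (vsum-new someNew) (∈-map⁺ (vsum J ext) (∈-allFin (new someNew)))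
      ⊇ (there c∈) with ∈-map⁻ shift c∈
      ... | d , d∈ , refl with ∈-map⁻ (vsum G ℓ) (∈-deduplicate⁻ _≟_ colours d∈)
      ...   | i , _ , refl = subst (_∈ map (vsum J ext) (verts J)) (vsum-old i) (∈-map⁺ (vsum J ext) (∈-allFin (old i)))

-- The theorem and its iteration

Both : Graph → ℕ → Set
Both G k = IsChromaticNumber G k × IsLocalAntimagicChromaticNumber G k

-- Both numbers grow by one, so their equality survives and the step can be iterated. The extended
-- labelling bounds χ_la from above, the chromatic number of the join from below.
join-both : ∀ G r s t {k} → n G ≡ s + (t + t) → 2 ≤ s → 1 ≤ t → t ≤ r → Regular G (2 * r) → Both G k → Both (G ∨G O s) (suc k)
join-both G r s t m≡ 2≤s 1≤t t≤r reg (χ , (ℓ , anti , num) , _) =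
  χ′ , (ext ℓ , ext-antimagic ℓ anti , trans (ext-numColours ℓ) (cong suc num)) ,
  λ ℓ′ anti′ → proj₂ χ′ _ (colouring J ℓ′ anti′)
  where
  open JoinLabelling G s t r m≡ 2≤s 1≤t t≤r reg
  χ′ : IsChromaticNumber J _
  χ′ = chromatic someNew χ

theorem3p3 : (G : Graph) (r t k : ℕ) →
    3 ≤ order G → Regular G (2 * r) →
    IsChromaticNumber G k → IsLocalAntimagicChromaticNumber G k →
    (2 ≤ r → 1 ≤ t → t ≤ r → 2 ≤ order G ∸ 2 * t →
    IsLocalAntimagicChromaticNumber (G ∨G O (order G ∸ 2 * t)) (suc k))
    ×
    (2 ≤ r → 2 ∣ order G → 2 ≤ order G ∸ 2 * r →
    (∀ j →
    Regular (iterJoin G (order G ∸ 2 * r) (suc j)) (2 * r + suc j * (order G ∸ 2 * r))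
    × order (iterJoin G (order G ∸ 2 * r) (suc j)) ≡ order G + suc j * (order G ∸ 2 * r))
    × (∀ j → IsLocalAntimagicChromaticNumber (iterJoin G (order G ∸ 2 * r) j) (k + j)))
theorem3p3 G r t k _ reg χ χla =
  (λ _ 1≤t t≤r 2≤s → proj₂ (join-both G r _ t (split t 2≤s) 2≤s 1≤t t≤r reg (χ , χla))) ,
  λ 2≤r 2∣m 2≤s → (λ j → regular-iter 2≤s (suc j) , order-iter _ (suc j)) , λ j → proj₂ (both-iter 2≤r 2∣m 2≤s j)
  where
  split : ∀ t → 2 ≤ order G ∸ 2 * t → order G ≡ (order G ∸ 2 * t) + (t + t)
  -- A truncated difference of at least 2 is non-zero, hence 2t < m and the subtraction is exact.
  split t 2≤s = trans (sym (m∸n+n≡m {order G} {2 * t} (<⇒≤ (m∸n≢0⇒n<m λ e → contradiction (subst (2 ≤_) e 2≤s) λ ()))))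
    (cong (λ d → order G ∸ 2 * t + (t + d)) (+-identityʳ t))
  order-iter : ∀ s j → order (iterJoin G s j) ≡ order G + j * s
  order-iter s zero    = sym (+-identityʳ _)
  order-iter s (suc j) = trans (cong (_+ s) (order-iter s j)) (trans (+-assoc (order G) (j * s) s) (cong (order G +_) (+-comm (j * s) s)))
  -- Degree plus s equals the order at every stage, so old and new vertices of the next join both
  -- get the previous order as their degree.
  regular-iter : 2 ≤ order G ∸ 2 * r → ∀ j → Regular (iterJoin G (order G ∸ 2 * r) j) (2 * r + j * (order G ∸ 2 * r))
  regular-iter 2≤s zero    = subst (Regular G) (sym (+-identityʳ _)) reg
  regular-iter 2≤s (suc j) = subst (Regular (iterJoin G s (suc j))) (trans (order-iter s j) (trans (cong (_+ j * s) (split r 2≤s)) (eq s r (j * s))))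
    (Join.regular (iterJoin G s j) s (regular-iter 2≤s j)
      (sym (trans (order-iter s j) (trans (cong (_+ j * s) (split r 2≤s)) (eq′ s r (j * s))))))
    where
    s : ℕ
    s = order G ∸ 2 * r
    eq : ∀ s r x → s + (r + r) + x ≡ 2 * r + (s + x)
    eq = ℕSolver.solve-∀
    eq′ : ∀ s r x → s + (r + r) + x ≡ 2 * r + x + s
    eq′ = ℕSolver.solve-∀
  -- The j-th graph has degree 2r′ and order s + 2r′, where r′ = r + jh and h = s/2. The join step
  -- thus applies with r′ in the place of both r and t.
  both-iter : 2 ≤ r → 2 ∣ order G → 2 ≤ order G ∸ 2 * r → ∀ j → Both (iterJoin G (order G ∸ 2 * r) j) (k + j)
  both-iter 2≤r _ 2≤s zero    = subst (Both G) (sym (+-identityʳ k)) (χ , χla)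
  both-iter 2≤r 2∣m@(divides c m≡c*2) 2≤s (suc j) = subst (Both (iterJoin G s (suc j))) (sym (+-suc k j))
    (join-both (iterJoin G s j) r′ s r′ (trans (order-iter s j) (trans (cong (_+ j * s) (split r 2≤s))
        (trans (+-assoc s (r + r) (j * s)) (cong (s +_) (trans (cong (λ d → r + r + j * d) s≡2h) (eq₁ r j h))))))
      2≤s (≤-trans (≤-trans (s≤s z≤n) 2≤r) (m≤m+n r (j * h))) ≤-refl
      (subst (Regular (iterJoin G s j)) (trans (cong (λ d → 2 * r + j * d) s≡2h) (eq₂ r j h)) (regular-iter 2≤s j))
      (both-iter 2≤r 2∣m 2≤s j))
    where
    s h r′ : ℕ
    s = order G ∸ 2 * r
    -- Since m = 2c, this is half of s = m - 2r.
    h = c ∸ r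
    r′ = r + j * h
    s≡2h : s ≡ h * 2
    s≡2h = trans (cong₂ _∸_ m≡c*2 (*-comm 2 r)) (sym (*-distribʳ-∸ 2 c r))
    eq₁ : ∀ r j h → r + r + j * (h * 2) ≡ r + j * h + (r + j * h)
    eq₁ = ℕSolver.solve-∀
    eq₂ : ∀ r j h → 2 * r + j * (h * 2) ≡ 2 * (r + j * h)
    eq₂ = ℕSolver.solve-∀
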